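{- Let $n\ge3$ be an odd integer, $d,k\ge1$ integers, and $E\subset\mathbb{Z}_n^d$. Suppose that \[ |E|\gg\frac{\sqrt{\tau(n)}\,n^{d+\frac{k-1}{2}}}{\gamma(n)^{(d-1)/2}}. \] Then \[ \frac{1}{|E|^k}\sum_{y^1,\dots,y^k\in E}\left|\Pi_{y^1,\dots,y^k}(E)\right|\gg n^k. \]
   Context: For $x,y\in\mathbb{Z}_n^d$, $x\cdot y=x_1y_1+\dots+x_dy_d$. For $y^1,\dots,y^k\in\mathbb{Z}_n^d$, the dot-product $k$-star set is $\Pi_{y^1,\dots,y^k}(E)=\{(x\cdot y^1,\dots,x\cdot y^k)\in\mathbb{Z}_n^k : x\in E\}$. $\gamma(n)$ is the smallest prime divisor of $n$, $\tau(n)$ the number of divisors of $n$. $X\gg Y$ means $X\ge CY$ for a constant $C>0$ independent of $n$ and $E$ (possibly depending on $d,k$); a hypothesis $|E|\gg Y$ means $|E|\ge CY$ for a suitable sufficiently large such constant. -}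

module Defs where

open import Data.Nat using (ℕ; zero; suc; _+_; _*_; _%_)
open import Data.Nat.Divisibility using (_∣?_)
open import Data.Nat.Primality using (prime?)
open import Data.Fin using (Fin; toℕ)
open import Data.Nat.ListAction using (sum)
open import Data.List using (List; []; _∷_; [_]; length; filter; map; concatMap; upTo; deduplicate)
open import Data.Vec as V using (Vec)
import Data.Vec.Properties as VP
open import Data.Nat.Properties using () renaming (_≟_ to _≟ℕ_)
open import Relation.Nullary.Decidable using (_×-dec_)

-- reduction modulo n (n = 0 never occurs in the theorem, since n ≥ 3)
modn : ℕ → ℕ → ℕ
modn zero a = a
modn (suc m) a = a % suc m

dot : (n : ℕ) {d : ℕ} → Vec (Fin n) d → Vec (Fin n) d → ℕ
dot n x y = modn n (V.sum (V.zipWith (λ a b → toℕ a * toℕ b) x y))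

Pi : (n : ℕ) {d k : ℕ} → Vec (Vec (Fin n) d) k → List (Vec (Fin n) d) → List (Vec ℕ k)
Pi n ys E = deduplicate (VP.≡-dec _≟ℕ_) (map (λ x → V.map (dot n x) ys) E)

tuples : {A : Set} → List A → (k : ℕ) → List (Vec A k)
tuples xs zero = [ V.[] ]
tuples xs (suc k) = concatMap (λ x → map (x V.∷_) (tuples xs k)) xs

starSum : (n : ℕ) {d : ℕ} (k : ℕ) → List (Vec (Fin n) d) → ℕ
starSum n k E = sum (map (λ ys → length (Pi n ys E)) (tuples E k))

τ : ℕ → ℕ
τ n = length (filter (_∣? n) (map suc (upTo n)))

-- γ(n): smallest prime divisor of n (default n if none, irrelevant for n ≥ 2)
γ : ℕ → ℕ
γ n with filter (λ p → prime? p ×-dec (p ∣? n)) (upTo (suc n))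
... | [] = n
... | p ∷ _ = p

{-# OPTIONS --safe #-}
-- Put e = |E| and ν_z(t) = #{y ∈ E : z·y = t}. The number of z ∈ ℤₙᵈ with z·x = z·y is at most nᵈ⁻¹ g for
-- g = gcd(x - y, n), and for each divisor g > 1 of n at most (n/g)ᵈ vectors x are congruent to y modulo g.
-- Hence the variance V = Σ_z Σ_t (n ν_z(t) - e)² satisfies γ(n)ᵈ⁻¹ V ≤ n²ᵈ⁺¹ e τ(n).
-- This controls the moments M_k = Σ_{x,z ∈ E} #{y ∈ E : x·y = z·y}ᵏ: for k = 1 by restricting the sum over z
-- to E, for k ≥ 2 by bounding all but two factors by e and keeping only t = 0. The result is
-- nᵏ M_k = O(eᵏ⁺²). Finally M_k counts the pairs in E² with equal image under x ↦ (x·y¹,…,x·yᵏ), summed over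
-- (y¹,…,yᵏ), so a Cauchy–Schwarz argument bounds the images from below.
module Submission where

open import Defs
open import Data.Nat using (ℕ; zero; suc; _*_; _^_; _∸_; _≤_; _<_; _%_; _/_; _+_; _⊔_; z≤n; s≤s; NonZero; >-nonZero; >-nonZero⁻¹; ≢-nonZero; ≢-nonZero⁻¹)
open import Data.Nat.Properties
open import Data.Nat.DivMod using (m≡m%n+[m/n]*n; m<n*o⇒m/o<n; m%n<n; m%n%n≡m%n; m/n*n≡m; m<n⇒m%n≡m)
open import Data.Nat.Divisibility as ℕ∣ using (_∣_; divides; ∣⇒≤)
open import Data.Nat.Coprimality as Coprimality using (Coprime; coprime-divisor; coprime-/gcd)
open import Data.Nat.GCD using (gcd; gcd[m,n]∣m; gcd[m,n]∣n)
open import Data.Nat.ListAction using (sum; product)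
open import Data.Nat.ListAction.Properties using (sum-++)
open import Data.Nat.Primality using (Prime; prime?; prime⇒nonZero)
open import Data.Nat.Primality.Factorisation using (factorise)
open import Data.Nat.Tactic.RingSolver using (solve-∀)
open import Data.Integer as ℤ using (ℤ; +_; ∣_∣; 0ℤ)
import Data.Integer.Properties as ℤ
import Data.Integer.Tactic.RingSolver as ℤ
open import Data.Integer.DivMod using (_%ℕ_; _/ℕ_; a≡a%ℕn+[a/ℕn]*n; n%ℕd<d)
open import Data.Integer.Divisibility.Signed as ℤ∣ using (_∣?_; ∣⇒∣ᵤ; ∣ᵤ⇒∣) renaming (_∣_ to _∣ℤ_; divides to dividesℤ)
open import Data.Fin as F using (Fin; toℕ)
open import Data.Fin.Properties using (toℕ-injective; toℕ<n; any?; toℕ-fromℕ<) renaming (_≟_ to _≟F_)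
open import Data.Vec as V using (Vec; []; _∷_)
import Data.Vec.Properties as VP
open import Data.Vec.Relation.Binary.Pointwise.Inductive as PW using (Pointwise; []; _∷_)
open import Data.Vec.Relation.Unary.All as VA using ([]; _∷_)
open import Data.List using (List; []; _∷_; length; map; concatMap; upTo; allFin; filter; deduplicate)
open import Data.List.Properties using (map-++; map-∘; length-applyUpTo; length-tabulate)
open import Data.List.Membership.Propositional using (_∈_; lose)
open import Data.List.Membership.Propositional.Properties using (∈-map⁺; ∈-concatMap⁺; ∈-deduplicate⁺; ∈-upTo⁺; ∈-allFin; ∈-filter⁺; ∈-filter⁻)
open import Data.List.Relation.Unary.Any using (here; there)
open import Data.List.Relation.Unary.All as All using ([]; _∷_)
open import Data.List.Relation.Unary.AllPairs using ([]; _∷_)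
import Data.List.Relation.Unary.AllPairs.Properties as AllPairs
open import Data.List.Relation.Unary.Unique.Propositional using (Unique)
open import Data.List.Relation.Unary.Unique.Propositional.Properties using (allFin⁺; upTo⁺)
open import Data.List.Relation.Unary.Unique.DecPropositional.Properties using (deduplicate-!)
open import Data.Product using (∃-syntax; _×_; _,_; proj₁; proj₂)
open import Data.Sum using (inj₁; inj₂)
open import Function using (_∘_; id)
open import Relation.Binary using (DecidableEquality)
open import Relation.Binary.PropositionalEquality using (_≡_; refl; sym; trans; cong; cong₂; subst; subst₂; module ≡-Reasoning)
open import Relation.Nullary using (Dec; yes; no; ¬_; contradiction)
open import Relation.Nullary.Decidable using (_×-dec_)


private
  variable
    A B : Set
    P Q R : Set

-- Finite sums

∑ : List A → (A → ℕ) → ℕ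
∑ xs f = sum (map f xs)

-- The prefix binds tighter than _*_ and _+_: a compound summand needs parentheses.
syntax ∑ xs (λ x → e) = ∑[ x ∈ xs ] e

∑-cong-∈ : ∀ (xs : List A) {f g : A → ℕ} → (∀ {x} → x ∈ xs → f x ≡ g x) → ∑ xs f ≡ ∑ xs g
∑-cong-∈ []       eq = refl
∑-cong-∈ (x ∷ xs) eq = cong₂ _+_ (eq (here refl)) (∑-cong-∈ xs (eq ∘ there))

∑-cong : ∀ (xs : List A) {f g : A → ℕ} → (∀ x → f x ≡ g x) → ∑ xs f ≡ ∑ xs g
∑-cong xs eq = ∑-cong-∈ xs (λ {x} _ → eq x)

∑-mono-∈ : ∀ (xs : List A) {f g : A → ℕ} → (∀ {x} → x ∈ xs → f x ≤ g x) → ∑ xs f ≤ ∑ xs g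
∑-mono-∈ []       le = z≤n
∑-mono-∈ (x ∷ xs) le = +-mono-≤ (le (here refl)) (∑-mono-∈ xs (le ∘ there))

∑-mono : ∀ (xs : List A) {f g : A → ℕ} → (∀ x → f x ≤ g x) → ∑ xs f ≤ ∑ xs g
∑-mono xs le = ∑-mono-∈ xs (λ {x} _ → le x)

∑-∈-≤ : ∀ {xs : List A} (f : A → ℕ) {x} → x ∈ xs → f x ≤ ∑ xs f
∑-∈-≤ f (here refl)        = m≤m+n _ _
∑-∈-≤ f (there {x = y} x∈) = ≤-trans (∑-∈-≤ f x∈) (m≤n+m _ (f y))

∑-const : ∀ (xs : List A) c → ∑[ _ ∈ xs ] c ≡ length xs * c
∑-const []       c = refl
∑-const (x ∷ xs) c = cong (λ s → c + s) (∑-const xs c)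

∑-+ : ∀ (xs : List A) (f g : A → ℕ) → ∑[ x ∈ xs ] (f x + g x) ≡ ∑ xs f + ∑ xs g
∑-+ []       f g = refl
∑-+ (x ∷ xs) f g rewrite ∑-+ xs f g = lemma (f x) (g x) (∑ xs f) (∑ xs g)
  where
  lemma : ∀ a b c d → a + b + (c + d) ≡ a + c + (b + d)
  lemma = solve-∀

∑-*ˡ : ∀ (xs : List A) c (f : A → ℕ) → ∑[ x ∈ xs ] (c * f x) ≡ c * ∑ xs f
∑-*ˡ []       c f = sym (*-zeroʳ c)
∑-*ˡ (x ∷ xs) c f = trans (cong (λ s → c * f x + s) (∑-*ˡ xs c f)) (sym (*-distribˡ-+ c (f x) _))

∑-*ʳ : ∀ (xs : List A) c (f : A → ℕ) → ∑[ x ∈ xs ] (f x * c) ≡ ∑ xs f * c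
∑-*ʳ xs c f = trans (∑-cong xs (λ x → *-comm (f x) c)) (trans (∑-*ˡ xs c f) (*-comm c _))

∑-swap : ∀ (xs : List A) (ys : List B) (f : A → B → ℕ) →
         ∑[ x ∈ xs ] ∑[ y ∈ ys ] f x y ≡ ∑[ y ∈ ys ] ∑[ x ∈ xs ] f x y
∑-swap []       ys f = sym (trans (∑-const ys 0) (*-zeroʳ (length ys)))
∑-swap (x ∷ xs) ys f = trans (cong (λ s → ∑ ys (f x) + s) (∑-swap xs ys f))
                             (sym (∑-+ ys (f x) (λ y → ∑[ x ∈ xs ] f x y)))

∑-*-∑ : ∀ (xs : List A) (ys : List B) (f : A → ℕ) (g : B → ℕ) →
        ∑ xs f * ∑ ys g ≡ ∑[ x ∈ xs ] ∑[ y ∈ ys ] (f x * g y)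
∑-*-∑ xs ys f g = trans (sym (∑-*ʳ xs (∑ ys g) f)) (∑-cong xs (λ x → sym (∑-*ˡ ys (f x) g)))

∑-concatMap : ∀ (xs : List A) (h : A → List B) (f : B → ℕ) →
              ∑ (concatMap h xs) f ≡ ∑[ x ∈ xs ] ∑ (h x) f
∑-concatMap []       h f = refl
∑-concatMap (x ∷ xs) h f = trans (cong sum (map-++ f (h x) (concatMap h xs)))
  (trans (sum-++ (map f (h x)) _) (cong (λ s → ∑ (h x) f + s) (∑-concatMap xs h f)))

∑-tuples-suc : ∀ (xs : List A) k (f : Vec A (suc k) → ℕ) →
               ∑ (tuples xs (suc k)) f ≡ ∑[ x ∈ xs ] ∑[ v ∈ tuples xs k ] f (x ∷ v)
∑-tuples-suc xs k f = trans (∑-concatMap xs (λ x → map (x ∷_) (tuples xs k)) f)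
  (∑-cong xs (λ x → cong sum (sym (map-∘ (tuples xs k)))))

length-∑ : ∀ (xs : List A) → length xs ≡ ∑[ _ ∈ xs ] 1
length-∑ xs = sym (trans (∑-const xs 1) (*-identityʳ _))

∑-tuples-const : ∀ (xs : List A) k c → ∑[ _ ∈ tuples xs k ] c ≡ length xs ^ k * c
∑-tuples-const xs zero    c = refl
∑-tuples-const xs (suc k) c = begin
  ∑[ _ ∈ tuples xs (suc k) ] c          ≡⟨ ∑-tuples-suc xs k (λ _ → c) ⟩
  ∑[ _ ∈ xs ] ∑[ _ ∈ tuples xs k ] c    ≡⟨ ∑-const xs _ ⟩
  length xs * ∑[ _ ∈ tuples xs k ] c    ≡⟨ cong (length xs *_) (∑-tuples-const xs k c) ⟩
  length xs * (length xs ^ k * c)       ≡⟨ *-assoc (length xs) _ c ⟨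
  length xs ^ suc k * c                 ∎
  where open ≡-Reasoning

∈-tuples : ∀ (xs : List A) → (∀ x → x ∈ xs) → ∀ {k} (v : Vec A k) → v ∈ tuples xs k
∈-tuples xs full []      = here refl
∈-tuples xs full (x ∷ v) = ∈-concatMap⁺ _ (lose (full x) (∈-map⁺ (x ∷_) (∈-tuples xs full v)))

-- Indicators and fibre counts

𝟙 : Dec P → ℕ
𝟙 (yes _) = 1
𝟙 (no  _) = 0

𝟙-mono : (P → Q) → (p? : Dec P) (q? : Dec Q) → 𝟙 p? ≤ 𝟙 q?
𝟙-mono f (yes p) (yes q) = s≤s z≤n
𝟙-mono f (yes p) (no ¬q) = contradiction (f p) ¬q
𝟙-mono f (no ¬p) q?      = z≤n

𝟙-yes : (p? : Dec P) → P → 𝟙 p? ≡ 1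
𝟙-yes (yes _) p = refl
𝟙-yes (no ¬p) p = contradiction p ¬p

𝟙-no : (p? : Dec P) → ¬ P → 𝟙 p? ≡ 0
𝟙-no (yes p) ¬p = contradiction p ¬p
𝟙-no (no _)  ¬p = refl

𝟙≤1 : (p? : Dec P) → 𝟙 p? ≤ 1
𝟙≤1 (yes _) = s≤s z≤n
𝟙≤1 (no _)  = z≤n

𝟙-* : (p? : Dec P) (q? : Dec Q) → 𝟙 (p? ×-dec q?) ≡ 𝟙 p? * 𝟙 q?
𝟙-* (yes p) (yes q) = refl
𝟙-* (yes p) (no ¬q) = refl
𝟙-* (no ¬p) (yes q) = refl
𝟙-* (no ¬p) (no ¬q) = refl

𝟙-mono-* : (R → P × Q) → (r? : Dec R) (p? : Dec P) (q? : Dec Q) → 𝟙 r? ≤ 𝟙 p? * 𝟙 q?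
𝟙-mono-* f r? p? q? = ≤-trans (𝟙-mono f r? (p? ×-dec q?)) (≤-reflexive (𝟙-* p? q?))

module _ (_≟_ : DecidableEquality B) where

  ∑-fibre≤1 : ∀ {xs : List A} → Unique xs → (f : A → B) → (∀ {x y} → f x ≡ f y → x ≡ y) →
              ∀ b → ∑[ x ∈ xs ] 𝟙 (f x ≟ b) ≤ 1
  ∑-fibre≤1 []                       f inj b = z≤n
  ∑-fibre≤1 {xs = x ∷ xs} (x∉ ∷ u)   f inj b with f x ≟ b
  ... | no  _    = ∑-fibre≤1 u f inj b
  ... | yes refl = s≤s (≤-reflexive (trans (∑-cong-∈ xs none) (trans (∑-const xs 0) (*-zeroʳ (length xs)))))
    where
    none : ∀ {y} → y ∈ xs → 𝟙 (f y ≟ f x) ≡ 0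
    none {y} y∈ = 𝟙-no (f y ≟ f x) (λ eq → All.lookup x∉ y∈ (inj (sym eq)))

  -- Each `φ (f x)` is one term of an indicator-weighted sum over `ys`; after exchanging the sums,
  -- injectivity charges each y at most once. This enlarges sums over `E` to all of ℤₙᵈ, directly or
  -- after a translation.
  ∑-inj-≤ : ∀ {xs : List A} {ys : List B} → Unique xs → (f : A → B) → (∀ {x y} → f x ≡ f y → x ≡ y) →
            (∀ x → f x ∈ ys) → (φ : B → ℕ) → ∑[ x ∈ xs ] φ (f x) ≤ ∑ ys φ
  ∑-inj-≤ {xs = xs} {ys} u f inj f∈ φ = begin
    ∑[ x ∈ xs ] φ (f x)                              ≤⟨ ∑-mono xs step ⟩
    ∑[ x ∈ xs ] ∑[ y ∈ ys ] (𝟙 (f x ≟ y) * φ y)      ≡⟨ ∑-swap xs ys _ ⟩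
    ∑[ y ∈ ys ] ∑[ x ∈ xs ] (𝟙 (f x ≟ y) * φ y)      ≡⟨ ∑-cong ys (λ y → ∑-*ʳ xs (φ y) _) ⟩
    ∑[ y ∈ ys ] (∑[ x ∈ xs ] 𝟙 (f x ≟ y) * φ y)      ≤⟨ ∑-mono ys (λ y → *-monoˡ-≤ (φ y) (∑-fibre≤1 u f inj y)) ⟩
    ∑[ y ∈ ys ] (1 * φ y)                            ≡⟨ ∑-cong ys (λ y → *-identityˡ (φ y)) ⟩
    ∑ ys φ                                           ∎
    where
    open ≤-Reasoning
    step : ∀ x → φ (f x) ≤ ∑[ y ∈ ys ] (𝟙 (f x ≟ y) * φ y)
    step x = begin
      φ (f x)                              ≡⟨ *-identityˡ _ ⟨
      1 * φ (f x)                          ≡⟨ cong (_* φ (f x)) (𝟙-yes (f x ≟ f x) refl) ⟨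
      𝟙 (f x ≟ f x) * φ (f x)              ≤⟨ ∑-∈-≤ (λ y → 𝟙 (f x ≟ y) * φ y) (f∈ x) ⟩
      ∑[ y ∈ ys ] (𝟙 (f x ≟ y) * φ y)      ∎

  ∑-𝟙-≟ : ∀ {ts : List B} → Unique ts → ∀ {b} → b ∈ ts → (φ : B → ℕ) →
          ∑[ t ∈ ts ] (𝟙 (b ≟ t) * φ t) ≡ φ b
  ∑-𝟙-≟ {ts = t ∷ ts} (t∉ ∷ u) {b} b∈ φ with b ≟ t
  ... | yes refl = trans (cong₂ _+_ (*-identityˡ (φ t))
                     (trans (∑-cong-∈ ts none) (trans (∑-const ts 0) (*-zeroʳ (length ts))))) (+-identityʳ _)
    where
    none : ∀ {s} → s ∈ ts → 𝟙 (t ≟ s) * φ s ≡ 0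
    none {s} s∈ = cong (_* φ s) (𝟙-no (t ≟ s) (All.lookup t∉ s∈))
  ... | no b≢t with b∈
  ...   | here b≡t  = contradiction b≡t b≢t
  ...   | there b∈′ = ∑-𝟙-≟ u b∈′ φ

  module _ {ts : List B} (ts! : Unique ts) (xs : List A) (f : A → B) (f∈ : ∀ {x} → x ∈ xs → f x ∈ ts) where

    ∑-fibres : ∑[ t ∈ ts ] ∑[ x ∈ xs ] 𝟙 (f x ≟ t) ≡ length xs
    ∑-fibres = begin
      ∑[ t ∈ ts ] ∑[ x ∈ xs ] 𝟙 (f x ≟ t)        ≡⟨ ∑-swap ts xs _ ⟩
      ∑[ x ∈ xs ] ∑[ t ∈ ts ] 𝟙 (f x ≟ t)        ≡⟨ ∑-cong xs (λ x → ∑-cong ts (λ t → *-identityʳ _)) ⟨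
      ∑[ x ∈ xs ] ∑[ t ∈ ts ] (𝟙 (f x ≟ t) * 1)  ≡⟨ ∑-cong-∈ xs (λ x∈ → ∑-𝟙-≟ ts! (f∈ x∈) (λ _ → 1)) ⟩
      ∑[ x ∈ xs ] 1                              ≡⟨ length-∑ xs ⟨
      length xs                                  ∎
      where open ≡-Reasoning

    -- Expand the square into pairs (x, y); for given x only t = f x survives. This converts second
    -- moments of fibre sizes into collision counts.
    ∑-fibres² : ∑[ t ∈ ts ] (∑[ x ∈ xs ] 𝟙 (f x ≟ t) * ∑[ x ∈ xs ] 𝟙 (f x ≟ t)) ≡ ∑[ x ∈ xs ] ∑[ y ∈ xs ] 𝟙 (f y ≟ f x)
    ∑-fibres² = begin
      ∑[ t ∈ ts ] (∑[ x ∈ xs ] 𝟙 (f x ≟ t) * ∑[ x ∈ xs ] 𝟙 (f x ≟ t))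
        ≡⟨ ∑-cong ts (λ t → ∑-*-∑ xs xs _ _) ⟩
      ∑[ t ∈ ts ] ∑[ x ∈ xs ] ∑[ y ∈ xs ] (𝟙 (f x ≟ t) * 𝟙 (f y ≟ t))
        ≡⟨ ∑-swap ts xs _ ⟩
      ∑[ x ∈ xs ] ∑[ t ∈ ts ] ∑[ y ∈ xs ] (𝟙 (f x ≟ t) * 𝟙 (f y ≟ t))
        ≡⟨ ∑-cong xs (λ x → ∑-swap ts xs _) ⟩
      ∑[ x ∈ xs ] ∑[ y ∈ xs ] ∑[ t ∈ ts ] (𝟙 (f x ≟ t) * 𝟙 (f y ≟ t))
        ≡⟨ ∑-cong-∈ xs (λ x∈ → ∑-cong xs (λ y → ∑-𝟙-≟ ts! (f∈ x∈) (λ t → 𝟙 (f y ≟ t)))) ⟩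
      ∑[ x ∈ xs ] ∑[ y ∈ xs ] 𝟙 (f y ≟ f x) ∎
      where open ≡-Reasoning

-- Truncation costs only an inequality: for b ≤ a the two sides agree, and for b = a + c the
-- truncated square vanishes while the right side keeps c².
[a∸b]²+2ab≤a²+b² : ∀ a b → (a ∸ b) * (a ∸ b) + 2 * (a * b) ≤ a * a + b * b
[a∸b]²+2ab≤a²+b² a b with ≤-total a b
... | inj₁ a≤b with c , refl ← m≤n⇒∃[o]m+o≡n a≤b rewrite m≤n⇒m∸n≡0 a≤b =
  ≤-trans (m≤m+n _ (c * c)) (≤-reflexive (lemma a c))
  where
  lemma : ∀ a c → 2 * (a * (a + c)) + c * c ≡ a * a + (a + c) * (a + c)
  lemma = solve-∀
... | inj₂ b≤a with c , refl ← m≤n⇒∃[o]m+o≡n b≤a rewrite m+n∸m≡n b c = ≤-reflexive (lemma b c)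
  where
  lemma : ∀ b c → c * c + 2 * ((b + c) * b) ≡ (b + c) * (b + c) + b * b
  lemma = solve-∀

2ab≤a²+b² : ∀ a b → 2 * (a * b) ≤ a * a + b * b
2ab≤a²+b² a b = ≤-trans (m≤n+m _ ((a ∸ b) * (a ∸ b))) ([a∸b]²+2ab≤a²+b² a b)

module _ (_≟_ : DecidableEquality B) (xs : List A) (f : A → B) where

  -- Summing 2λμν ≤ λ² + μ²ν² over the image, where ν is the fibre size, replaces Cauchy–Schwarz.
  image-size : ∀ l m → 2 * (l * m) * length xs ≤
    (l * l) * length (deduplicate _≟_ (map f xs)) + (m * m) * ∑[ x ∈ xs ] ∑[ y ∈ xs ] 𝟙 (f y ≟ f x)
  image-size l m = begin
    2 * (l * m) * length xs                          ≡⟨ cong (2 * (l * m) *_) (∑-fibres _≟_ ts! xs f f∈) ⟨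
    2 * (l * m) * ∑ ts ν                             ≡⟨ ∑-*ˡ ts (2 * (l * m)) ν ⟨
    ∑[ t ∈ ts ] (2 * (l * m) * ν t)                  ≤⟨ ∑-mono ts (λ t → pointwise (ν t)) ⟩
    ∑[ t ∈ ts ] (l * l + (m * m) * (ν t * ν t))            ≡⟨ ∑-+ ts _ _ ⟩
    ∑[ t ∈ ts ] (l * l) + ∑[ t ∈ ts ] ((m * m) * (ν t * ν t))
      ≡⟨ cong₂ _+_ (trans (∑-const ts (l * l)) (*-comm (length ts) _)) (∑-*ˡ ts (m * m) _) ⟩
    (l * l) * length ts + (m * m) * ∑[ t ∈ ts ] (ν t * ν t)
      ≡⟨ cong (λ s → (l * l) * length ts + m * m * s) (∑-fibres² _≟_ ts! xs f f∈) ⟩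
    (l * l) * length ts + (m * m) * ∑[ x ∈ xs ] ∑[ y ∈ xs ] 𝟙 (f y ≟ f x) ∎
    where
    open ≤-Reasoning
    ts = deduplicate _≟_ (map f xs)
    ts! = deduplicate-! _≟_ (map f xs)
    f∈ : ∀ {x} → x ∈ xs → f x ∈ ts
    f∈ x∈ = ∈-deduplicate⁺ _≟_ (∈-map⁺ f x∈)
    ν = λ t → ∑[ x ∈ xs ] 𝟙 (f x ≟ t)
    pointwise : ∀ v → 2 * (l * m) * v ≤ l * l + (m * m) * (v * v)
    pointwise v = ≤-trans (≤-reflexive (lemma₁ l m v)) (≤-trans (2ab≤a²+b² l (m * v)) (≤-reflexive (lemma₂ l m v)))
      where
      lemma₁ : ∀ l m v → 2 * (l * m) * v ≡ 2 * (l * (m * v))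
      lemma₁ = solve-∀
      lemma₂ : ∀ l m v → l * l + (m * v) * (m * v) ≡ l * l + (m * m) * (v * v)
      lemma₂ = solve-∀

-- Counting solutions of congruences

%-≡⇒∣ : ∀ {n} .{{_ : NonZero n}} a b → a % n ≡ b % n → + n ∣ℤ (+ a ℤ.- + b)
%-≡⇒∣ {n} a b eq = dividesℤ (+ (a / n) ℤ.- + (b / n)) (begin
  + a ℤ.- + b
    ≡⟨ cong₂ ℤ._-_ (split a) (split b) ⟩
  (+ (a % n) ℤ.+ + (a / n) ℤ.* + n) ℤ.- (+ (b % n) ℤ.+ + (b / n) ℤ.* + n)
    ≡⟨ cong (λ r → (+ r ℤ.+ + (a / n) ℤ.* + n) ℤ.- (+ (b % n) ℤ.+ + (b / n) ℤ.* + n)) eq ⟩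
  (+ (b % n) ℤ.+ + (a / n) ℤ.* + n) ℤ.- (+ (b % n) ℤ.+ + (b / n) ℤ.* + n)
    ≡⟨ lemma (+ (b % n)) (+ (a / n)) (+ (b / n)) (+ n) ⟩
  (+ (a / n) ℤ.- + (b / n)) ℤ.* + n ∎)
  where
  open ≡-Reasoning
  split : ∀ a → + a ≡ + (a % n) ℤ.+ + (a / n) ℤ.* + n
  split a = trans (cong +_ (m≡m%n+[m/n]*n a n))
    (cong (ℤ._+_ (+ (a % n))) (ℤ.pos-* (a / n) n))
  lemma : ∀ r s t n → (r ℤ.+ s ℤ.* n) ℤ.- (r ℤ.+ t ℤ.* n) ≡ (s ℤ.- t) ℤ.* n
  lemma = ℤ.solve-∀

-- Two numbers in [0, q) differ by less than q in absolute value, and the only such multiple of q is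
-- 0.
∣-<⇒≡ : ∀ {q a b} → a < q → b < q → + q ∣ℤ (+ a ℤ.- + b) → a ≡ b
∣-<⇒≡ {q} {a} {b} a<q b<q q∣ = ℤ.+-injective (ℤ.i-j≡0⇒i≡j (+ a) (+ b) (ℤ.∣i∣≡0⇒i≡0 (n∣m<n⇒m≡0 (∣⇒∣ᵤ q∣) small)))
  where
  small : ∣ + a ℤ.- + b ∣ < q
  small = ≤-<-trans (subst (λ i → ∣ i ∣ ≤ a ⊔ b) (sym (ℤ.[+m]-[+n]≡m⊖n a b)) (ℤ.∣m⊝n∣≤m⊔n a b)) (⊔-lub a<q b<q)
  n∣m<n⇒m≡0 : ∀ {m n} → n ∣ m → m < n → m ≡ 0
  n∣m<n⇒m≡0 {zero}  _   _   = refl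
  n∣m<n⇒m≡0 {suc m} n∣m m<n = contradiction (∣⇒≤ n∣m) (<⇒≱ m<n)

∣-≡⇒≡ : ∀ {q a b} .{{_ : NonZero q}} → + q ∣ℤ (+ a ℤ.- + b) → a % q ≡ b % q
∣-≡⇒≡ {q} {a} {b} q∣ = ∣-<⇒≡ (m%n<n a q) (m%n<n b q)
  (subst (+ q ∣ℤ_) (lemma (+ a) (+ b) (+ (a % q)) (+ (b % q)))
     (ℤ∣.∣m∣n⇒∣m+n (ℤ∣.∣m∣n⇒∣m-n q∣ (%-≡⇒∣ a (a % q) (sym (m%n%n≡m%n a q)))) (%-≡⇒∣ b (b % q) (sym (m%n%n≡m%n b q)))))
  where
  lemma : ∀ a b r s → ((a ℤ.- b) ℤ.- (a ℤ.- r)) ℤ.+ (b ℤ.- s) ≡ r ℤ.- s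
  lemma = ℤ.solve-∀

quotient-nonZero : ∀ {q n} .{{_ : NonZero n}} → q ∣ n → NonZero q
quotient-nonZero {suc q} _ = _
quotient-nonZero {zero} {n = suc n} (divides m eq) = contradiction (trans eq (*-zeroʳ m)) (λ ())

-- With n = m q, every solution below n has the form r + j q, where r is the residue of w and j < m.
-- Each of these m values is attained by at most one z.
residue-count : ∀ {q n} .{{_ : NonZero n}} → q ∣ n → ∀ w →
                q * ∑[ z ∈ allFin n ] 𝟙 (+ q ∣? (+ toℕ z ℤ.- w)) ≤ n
residue-count {q} {n} (divides m refl) w = ≤-trans (*-monoʳ-≤ q bound) (≤-reflexive (*-comm q m))
  where
  instance
    q≢0 : NonZero q
    q≢0 = quotient-nonZero (divides m refl)
  r = w %ℕ q
  hit : ∀ {z} → z < m * q → + q ∣ℤ (+ z ℤ.- w) → z ≡ r + (z / q) * q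
  hit {z} z<n q∣ = trans (m≡m%n+[m/n]*n z q) (cong (_+ (z / q) * q) (∣-<⇒≡ (m%n<n z q) (n%ℕd<d w q)
    -- The witness is the quotient of z - w by q, corrected by the quotients of z and w that were
    -- split off with their residues.
    (dividesℤ (ℤ∣.quotient q∣ ℤ.- (+ (z / q) ℤ.- w /ℕ q)) (begin
      + (z % q) ℤ.- + r
        ≡⟨ lemma (+ (z % q)) (+ r) (+ (z / q)) (w /ℕ q) (+ q) ⟩
      ((+ (z % q) ℤ.+ + (z / q) ℤ.* + q) ℤ.- (+ r ℤ.+ w /ℕ q ℤ.* + q)) ℤ.- (+ (z / q) ℤ.- w /ℕ q) ℤ.* + q
        ≡⟨ cong₂ (λ a b → (a ℤ.- b) ℤ.- (+ (z / q) ℤ.- w /ℕ q) ℤ.* + q)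
             (trans (cong (ℤ._+_ (+ (z % q))) (sym (ℤ.pos-* (z / q) q))) (cong +_ (sym (m≡m%n+[m/n]*n z q))))
             (sym (a≡a%ℕn+[a/ℕn]*n w q)) ⟩
      (+ z ℤ.- w) ℤ.- (+ (z / q) ℤ.- w /ℕ q) ℤ.* + q
        ≡⟨ cong (ℤ._- (+ (z / q) ℤ.- w /ℕ q) ℤ.* + q) (ℤ∣._∣_.equality q∣) ⟩
      ℤ∣.quotient q∣ ℤ.* + q ℤ.- (+ (z / q) ℤ.- w /ℕ q) ℤ.* + q
        ≡⟨ lemma₂ (ℤ∣.quotient q∣) (+ (z / q) ℤ.- w /ℕ q) (+ q) ⟩
      (ℤ∣.quotient q∣ ℤ.- (+ (z / q) ℤ.- w /ℕ q)) ℤ.* + q ∎))))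
    where
    open ≡-Reasoning
    lemma : ∀ s r a b q → s ℤ.- r ≡ ((s ℤ.+ a ℤ.* q) ℤ.- (r ℤ.+ b ℤ.* q)) ℤ.- (a ℤ.- b) ℤ.* q
    lemma = ℤ.solve-∀
    lemma₂ : ∀ a b q → a ℤ.* q ℤ.- b ℤ.* q ≡ (a ℤ.- b) ℤ.* q
    lemma₂ = ℤ.solve-∀
  step : ∀ z → 𝟙 (+ q ∣? (+ toℕ z ℤ.- w)) ≤ ∑[ j ∈ upTo m ] 𝟙 (toℕ z ≟ r + j * q)
  step z with + q ∣? (+ toℕ z ℤ.- w)
  ... | no  _  = z≤n
  ... | yes q∣ = begin
    1                                          ≡⟨ 𝟙-yes (toℕ z ≟ r + (toℕ z / q) * q) (hit (toℕ<n z) q∣) ⟨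
    𝟙 (toℕ z ≟ r + (toℕ z / q) * q)            ≤⟨ ∑-∈-≤ (λ j → 𝟙 (toℕ z ≟ r + j * q)) (∈-upTo⁺ (m<n*o⇒m/o<n {n = m} {o = q} (toℕ<n z))) ⟩
    ∑[ j ∈ upTo m ] 𝟙 (toℕ z ≟ r + j * q)      ∎
    where open ≤-Reasoning
  bound : ∑[ z ∈ allFin n ] 𝟙 (+ q ∣? (+ toℕ z ℤ.- w)) ≤ m
  bound = begin
    ∑[ z ∈ allFin n ] 𝟙 (+ q ∣? (+ toℕ z ℤ.- w))                  ≤⟨ ∑-mono (allFin n) step ⟩
    ∑[ z ∈ allFin n ] ∑[ j ∈ upTo m ] 𝟙 (toℕ z ≟ r + j * q)       ≡⟨ ∑-swap (allFin n) (upTo m) _ ⟩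
    ∑[ j ∈ upTo m ] ∑[ z ∈ allFin n ] 𝟙 (toℕ z ≟ r + j * q)       ≤⟨ ∑-mono (upTo m) (λ j → ∑-fibre≤1 _≟_ (allFin⁺ n) toℕ toℕ-injective _) ⟩
    ∑[ _ ∈ upTo m ] 1                                             ≡⟨ length-∑ (upTo m) ⟨
    length (upTo m)                                               ≡⟨ length-applyUpTo id m ⟩
    m                                                             ∎
    where open ≤-Reasoning

module _ {n : ℕ} .{{n≢0 : NonZero n}} where

  -- Take g = gcd(a, h). Two solutions differ by a multiple of h / g, so all of them lie in one
  -- residue class, which has at most n g / h elements; and the existence of a solution forces g to
  -- divide c. Keeping this last condition as an indicator, for every c, lets the bound be iterated
  -- over coordinates.
  linear-congruence : ∀ {h} → h ∣ n → (a : ℤ) → ∃[ g ] g ∣ h × + g ∣ℤ a × (∀ c →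
    h * ∑[ z ∈ allFin n ] 𝟙 (+ h ∣? (c ℤ.+ + toℕ z ℤ.* a)) ≤ n * g * 𝟙 (+ g ∣? c))
  linear-congruence {h} h∣n a = g , gcd[m,n]∣n ∣ a ∣ h , g∣a , count
    where
    g = gcd ∣ a ∣ h
    instance
      h≢0 : NonZero h
      h≢0 = quotient-nonZero h∣n
      g≢0 : NonZero g
      g≢0 = quotient-nonZero (gcd[m,n]∣n ∣ a ∣ h)
    g∣a : + g ∣ℤ a
    g∣a = ∣ᵤ⇒∣ (gcd[m,n]∣m ∣ a ∣ h)
    h′ = h / g
    h≡ : h ≡ g * h′
    h≡ = trans (sym (m/n*n≡m (gcd[m,n]∣n ∣ a ∣ h))) (*-comm h′ g)
    h′∣h : h′ ∣ h
    h′∣h = divides g h≡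
    coprime : Coprime h′ (∣ a ∣ / g)
    coprime = Coprimality.sym (coprime-/gcd ∣ a ∣ h)
    -- Dividing h and a by g leaves coprime numbers, so h / g must divide i itself.
    cancel : ∀ i → h ∣ ∣ i ℤ.* a ∣ → h′ ∣ ∣ i ∣
    cancel i h∣ = coprime-divisor coprime (ℕ∣.*-cancelˡ-∣ g (subst₂ _∣_ h≡ eq h∣))
      where
      lemma : ∀ x y z → x * (y * z) ≡ z * (y * x)
      lemma = solve-∀
      eq : ∣ i ℤ.* a ∣ ≡ g * ((∣ a ∣ / g) * ∣ i ∣)
      eq = trans (ℤ.abs-* i a) (trans (cong (∣ i ∣ *_) (sym (m/n*n≡m (gcd[m,n]∣m ∣ a ∣ h)))) (lemma ∣ i ∣ (∣ a ∣ / g) g))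
    count : ∀ c → h * ∑[ z ∈ allFin n ] 𝟙 (+ h ∣? (c ℤ.+ + toℕ z ℤ.* a)) ≤ n * g * 𝟙 (+ g ∣? c)
    count c with any? (λ (z : Fin n) → + h ∣? (c ℤ.+ + toℕ z ℤ.* a))
    ... | no none = ≤-trans (≤-reflexive (trans (cong (h *_)
            (trans (∑-cong (allFin n) (λ z → 𝟙-no (+ h ∣? (c ℤ.+ + toℕ z ℤ.* a)) (λ h∣ → none (z , h∣)))) (trans (∑-const (allFin n) 0) (*-zeroʳ (length (allFin n)))))) (*-zeroʳ h))) z≤n
    -- Some solution z₀ serves as base point: every solution is congruent to it modulo `h′`.
    ... | yes (z₀ , h∣₀) = begin
      h * ∑[ z ∈ allFin n ] 𝟙 (+ h ∣? (c ℤ.+ + toℕ z ℤ.* a))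
        ≤⟨ *-monoʳ-≤ h (∑-mono (allFin n) (λ z → 𝟙-mono (λ h∣ → ∣ᵤ⇒∣ (cancel (+ toℕ z ℤ.- + toℕ z₀) (∣⇒∣ᵤ (diff z h∣)))) _ (+ h′ ∣? (+ toℕ z ℤ.- + toℕ z₀)))) ⟩
      h * N                 ≡⟨ cong (_* N) h≡ ⟩
      g * h′ * N            ≡⟨ *-assoc g h′ N ⟩
      g * (h′ * N)          ≤⟨ *-monoʳ-≤ g (residue-count (ℕ∣.∣-trans h′∣h h∣n) (+ toℕ z₀)) ⟩
      g * n                 ≡⟨ *-comm g n ⟩
      n * g                 ≡⟨ *-identityʳ (n * g) ⟨
      n * g * 1             ≡⟨ cong (n * g *_) (𝟙-yes (+ g ∣? c) g∣c) ⟨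
      n * g * 𝟙 (+ g ∣? c)  ∎
      where
      open ≤-Reasoning
      N = ∑[ z ∈ allFin n ] 𝟙 (+ h′ ∣? (+ toℕ z ℤ.- + toℕ z₀))
      lemma : ∀ c a z z₀ → (c ℤ.+ z ℤ.* a) ℤ.- (c ℤ.+ z₀ ℤ.* a) ≡ (z ℤ.- z₀) ℤ.* a
      lemma = ℤ.solve-∀
      diff : ∀ z → + h ∣ℤ (c ℤ.+ + toℕ z ℤ.* a) → + h ∣ℤ ((+ toℕ z ℤ.- + toℕ z₀) ℤ.* a)
      diff z h∣ = subst (+ h ∣ℤ_) (lemma c a (+ toℕ z) (+ toℕ z₀)) (ℤ∣.∣m∣n⇒∣m-n h∣ h∣₀)
      g∣c : + g ∣ℤ c
      g∣c = ℤ∣.∣m+n∣n⇒∣m (ℤ∣.∣-trans (∣ᵤ⇒∣ (gcd[m,n]∣n ∣ a ∣ h)) h∣₀) (ℤ∣.∣n⇒∣m*n (+ toℕ z₀) g∣a)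

  pairing : ∀ {d} → Vec (Fin n) d → Vec ℤ d → ℤ
  pairing []       []       = 0ℤ
  pairing (z ∷ zs) (a ∷ as) = + toℕ z ℤ.* a ℤ.+ pairing zs as

  -- Coordinates are eliminated one at a time: summing over the tail leaves the single congruence h
  -- | c + z a, and `linear-congruence` replaces h by gcd(a, h). The resulting g is the gcd of n and
  -- all coordinates of the vector; only its divisibility properties are recorded.
  congruence-count : ∀ {d} (a : Vec ℤ d) → ∃[ g ] g ∣ n × VA.All (+ g ∣ℤ_) a × (∀ c →
    n * ∑[ z ∈ tuples (allFin n) d ] 𝟙 (+ n ∣? (c ℤ.+ pairing z a)) ≤ n ^ d * g * 𝟙 (+ g ∣? c))
  congruence-count [] = n , ℕ∣.∣-refl , [] , λ c → ≤-reflexive (begin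
    n * (𝟙 (+ n ∣? (c ℤ.+ 0ℤ)) + 0)   ≡⟨ cong (n *_) (+-identityʳ _) ⟩
    n * 𝟙 (+ n ∣? (c ℤ.+ 0ℤ))         ≡⟨ cong (λ i → n * 𝟙 (+ n ∣? i)) (ℤ.+-identityʳ c) ⟩
    n * 𝟙 (+ n ∣? c)                  ≡⟨ cong (_* 𝟙 (+ n ∣? c)) (*-identityˡ n) ⟨
    1 * n * 𝟙 (+ n ∣? c)              ∎)
    where open ≡-Reasoning
  congruence-count {suc d} (a ∷ as)
    with h , h∣n , h∣as , count ← congruence-count as
    with g , g∣h , g∣a , count₁ ← linear-congruence h∣n a =
    g , ℕ∣.∣-trans g∣h h∣n , g∣a ∷ VA.map (ℤ∣.∣-trans (∣ᵤ⇒∣ g∣h)) h∣as , λ c → begin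
      n * ∑[ z ∈ tuples (allFin n) (suc d) ] 𝟙 (+ n ∣? (c ℤ.+ pairing z (a ∷ as)))
        ≡⟨ cong (n *_) (∑-tuples-suc (allFin n) d _) ⟩
      n * ∑[ z ∈ allFin n ] ∑[ zs ∈ tuples (allFin n) d ] 𝟙 (+ n ∣? (c ℤ.+ (+ toℕ z ℤ.* a ℤ.+ pairing zs as)))
        ≡⟨ ∑-*ˡ (allFin n) n _ ⟨
      ∑[ z ∈ allFin n ] (n * ∑[ zs ∈ tuples (allFin n) d ] 𝟙 (+ n ∣? (c ℤ.+ (+ toℕ z ℤ.* a ℤ.+ pairing zs as))))
        ≡⟨ ∑-cong (allFin n) (λ z → cong (n *_) (∑-cong (tuples (allFin n) d)
             (λ zs → cong (λ i → 𝟙 (+ n ∣? i)) (sym (ℤ.+-assoc c _ _))))) ⟩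
      ∑[ z ∈ allFin n ] (n * ∑[ zs ∈ tuples (allFin n) d ] 𝟙 (+ n ∣? (c ℤ.+ + toℕ z ℤ.* a ℤ.+ pairing zs as)))
        ≤⟨ ∑-mono (allFin n) (λ z → count (c ℤ.+ + toℕ z ℤ.* a)) ⟩
      ∑[ z ∈ allFin n ] (n ^ d * h * 𝟙 (+ h ∣? (c ℤ.+ + toℕ z ℤ.* a)))
        ≡⟨ ∑-*ˡ (allFin n) (n ^ d * h) _ ⟩
      n ^ d * h * ∑[ z ∈ allFin n ] 𝟙 (+ h ∣? (c ℤ.+ + toℕ z ℤ.* a))
        ≡⟨ *-assoc (n ^ d) h _ ⟩
      n ^ d * (h * ∑[ z ∈ allFin n ] 𝟙 (+ h ∣? (c ℤ.+ + toℕ z ℤ.* a)))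
        ≤⟨ *-monoʳ-≤ (n ^ d) (count₁ c) ⟩
      n ^ d * (n * g * 𝟙 (+ g ∣? c))
        ≡⟨ lemma (n ^ d) n g (𝟙 (+ g ∣? c)) ⟩
      n ^ suc d * g * 𝟙 (+ g ∣? c) ∎
    where
    open ≤-Reasoning
    lemma : ∀ x n g i → x * (n * g * i) ≡ n * x * g * i
    lemma = solve-∀

-- The variance of the dot products

prime-divisor : ∀ {g} → 1 < g → ∃[ p ] Prime p × p ∣ g
prime-divisor {suc g} 1<g with factorise (suc g)
... | record { factors = []     ; isFactorisation = eq } = contradiction (sym eq) (<⇒≢ 1<g)
... | record { factors = p ∷ ps ; isFactorisation = eq ; factorsPrime = pr ∷ _ } =
  p , pr , divides (product ps) (trans eq (*-comm p (product ps)))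

module _ (n : ℕ) .{{_ : NonZero n}} where

  prime-divisor? = λ p → prime? p ×-dec (p ℕ∣.∣? n)

  -- The list searched by `γ` is increasing and contains a prime factor of g, so its head is at most
  -- that prime.
  γ≤divisor : ∀ {g} → 1 < g → g ∣ n → γ n ≤ g
  γ≤divisor {g} 1<g g∣n with p , pr , p∣g ← prime-divisor 1<g = ≤-trans γ≤p (∣⇒≤ {{>-nonZero (<-trans (s≤s z≤n) 1<g)}} p∣g)
    where
    p∣n = ℕ∣.∣-trans p∣g g∣n
    γ≤p : γ n ≤ p
    -- The list, the membership and the ordering are abstracted together, so that splitting the list
    -- refines all three.
    γ≤p with filter prime-divisor? (upTo (suc n))
           | ∈-filter⁺ prime-divisor? (∈-upTo⁺ (s≤s (∣⇒≤ p∣n))) (pr , p∣n)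
           | AllPairs.filter⁺ prime-divisor? (AllPairs.applyUpTo⁺₁ {R = _<_} id (suc n) (λ i<j _ → i<j))
    ... | q ∷ qs | here refl | _       = ≤-refl
    ... | q ∷ qs | there p∈  | q< ∷ _  = <⇒≤ (All.lookup q< p∈)

  -- Allows powers of γ(n) to be cancelled. An empty list of prime divisors gives the default value
  -- `n`, nonzero by assumption.
  γ-nonZero : NonZero (γ n)
  γ-nonZero with filter prime-divisor? (upTo (suc n)) | (λ {p} → ∈-filter⁻ prime-divisor? {p} {upTo (suc n)})
  ... | []    | _  = ≢-nonZero (≢-nonZero⁻¹ n)
  ... | q ∷ _ | ∈⁻ = prime⇒nonZero (proj₁ (proj₂ (∈⁻ (here refl))))

-- Congruence of vectors and collisions of dot products

Congruent : ∀ (g : ℕ) {n d} → Vec (Fin n) d → Vec (Fin n) d → Set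
Congruent g = Pointwise (λ a b → + g ∣ℤ (+ toℕ a ℤ.- + toℕ b))

congruent? : ∀ g {n d} (x y : Vec (Fin n) d) → Dec (Congruent g x y)
congruent? g = PW.decidable (λ a b → + g ∣? (+ toℕ a ℤ.- + toℕ b))

dotℕ : ∀ {n d} → Vec (Fin n) d → Vec (Fin n) d → ℕ
dotℕ x y = V.sum (V.zipWith (λ a b → toℕ a * toℕ b) x y)

_⊖_ : ∀ {n d} → Vec (Fin n) d → Vec (Fin n) d → Vec ℤ d
_⊖_ = V.zipWith (λ a b → + toℕ a ℤ.- + toℕ b)

module _ {n : ℕ} .{{n≢0 : NonZero n}} where

  points : ∀ d → List (Vec (Fin n) d)
  points = tuples (allFin n)

  ∈-points : ∀ {d} (x : Vec (Fin n) d) → x ∈ points d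
  ∈-points = ∈-tuples (allFin n) ∈-allFin

  ∑-points-const : ∀ d c → ∑[ _ ∈ points d ] c ≡ n ^ d * c
  ∑-points-const d c = trans (∑-tuples-const (allFin n) d c) (cong (λ l → l ^ d * c) (length-tabulate {n = n} id))

  dot-% : ∀ {d} (x y : Vec (Fin n) d) → dot n x y ≡ dotℕ x y % n
  dot-% x y = lemma n (dotℕ x y)
    where
    lemma : ∀ n .{{_ : NonZero n}} a → modn n a ≡ a % n
    lemma (suc n) a = refl

  dot< : ∀ {d} (x y : Vec (Fin n) d) → dot n x y < n
  dot< x y = subst (_< n) (sym (dot-% x y)) (m%n<n (dotℕ x y) n)

  dot-comm : ∀ {d} (x y : Vec (Fin n) d) → dot n x y ≡ dot n y x
  dot-comm x y = cong (modn n ∘ V.sum) (VP.zipWith-comm (λ a b → *-comm (toℕ a) (toℕ b)) x y)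

  pairing-⊖ : ∀ {d} (z x y : Vec (Fin n) d) → pairing z (x ⊖ y) ≡ + dotℕ z x ℤ.- + dotℕ z y
  pairing-⊖ []       []       []       = refl
  pairing-⊖ (c ∷ z) (a ∷ x) (b ∷ y) = begin
    + toℕ c ℤ.* (+ toℕ a ℤ.- + toℕ b) ℤ.+ pairing z (x ⊖ y)
      ≡⟨ cong (ℤ._+_ (+ toℕ c ℤ.* (+ toℕ a ℤ.- + toℕ b))) (pairing-⊖ z x y) ⟩
    + toℕ c ℤ.* (+ toℕ a ℤ.- + toℕ b) ℤ.+ (+ dotℕ z x ℤ.- + dotℕ z y)
      ≡⟨ lemma (+ toℕ c) (+ toℕ a) (+ toℕ b) (+ dotℕ z x) (+ dotℕ z y) ⟩
    (+ toℕ c ℤ.* + toℕ a ℤ.+ + dotℕ z x) ℤ.- (+ toℕ c ℤ.* + toℕ b ℤ.+ + dotℕ z y)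
      ≡⟨ cong₂ (λ u v → (u ℤ.+ + dotℕ z x) ℤ.- (v ℤ.+ + dotℕ z y)) (ℤ.pos-* (toℕ c) (toℕ a)) (ℤ.pos-* (toℕ c) (toℕ b)) ⟨
    + dotℕ (c ∷ z) (a ∷ x) ℤ.- + dotℕ (c ∷ z) (b ∷ y) ∎
    where
    open ≡-Reasoning
    lemma : ∀ c a b x y → c ℤ.* (a ℤ.- b) ℤ.+ (x ℤ.- y) ≡ (c ℤ.* a ℤ.+ x) ℤ.- (c ℤ.* b ℤ.+ y)
    lemma = ℤ.solve-∀

  dot-≡⇒∣ : ∀ {d} (z x y : Vec (Fin n) d) → dot n z x ≡ dot n z y → + n ∣ℤ pairing z (x ⊖ y)
  dot-≡⇒∣ z x y eq = subst (+ n ∣ℤ_) (sym (pairing-⊖ z x y))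
    (%-≡⇒∣ (dotℕ z x) (dotℕ z y) (trans (sym (dot-% z x)) (trans eq (dot-% z y))))

  -- Congruence is a condition on each coordinate separately, so the count factors and
  -- `residue-count` bounds every factor.
  residue-class-count : ∀ {q} → q ∣ n → ∀ {d} (y : Vec (Fin n) d) →
    q ^ d * ∑[ z ∈ points d ] 𝟙 (congruent? q z y) ≤ n ^ d
  residue-class-count q∣n [] = s≤s z≤n
  residue-class-count {q} q∣n {suc d} (b ∷ y) = begin
    q ^ suc d * ∑[ z ∈ points (suc d) ] 𝟙 (congruent? q z (b ∷ y))
      ≡⟨ cong (q ^ suc d *_) (∑-tuples-suc (allFin n) d _) ⟩
    q ^ suc d * ∑[ c ∈ allFin n ] ∑[ z ∈ points d ] 𝟙 (congruent? q (c ∷ z) (b ∷ y))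
      ≤⟨ *-monoʳ-≤ (q ^ suc d) (∑-mono (allFin n) (λ c → ∑-mono (points d) (λ z →
           𝟙-mono-* PW.uncons (congruent? q (c ∷ z) (b ∷ y)) (+ q ∣? (+ toℕ c ℤ.- + toℕ b)) (congruent? q z y)))) ⟩
    q ^ suc d * ∑[ c ∈ allFin n ] ∑[ z ∈ points d ] (𝟙 (+ q ∣? (+ toℕ c ℤ.- + toℕ b)) * 𝟙 (congruent? q z y))
      ≡⟨ cong (q ^ suc d *_) (∑-*-∑ (allFin n) (points d) _ _) ⟨
    q ^ suc d * (∑[ c ∈ allFin n ] 𝟙 (+ q ∣? (+ toℕ c ℤ.- + toℕ b)) * ∑[ z ∈ points d ] 𝟙 (congruent? q z y))
      ≡⟨ lemma q (q ^ d) _ _ ⟩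
    (q * ∑[ c ∈ allFin n ] 𝟙 (+ q ∣? (+ toℕ c ℤ.- + toℕ b))) * (q ^ d * ∑[ z ∈ points d ] 𝟙 (congruent? q z y))
      ≤⟨ *-mono-≤ (residue-count q∣n (+ toℕ b)) (residue-class-count q∣n y) ⟩
    n ^ suc d ∎
    where
    open ≤-Reasoning
    lemma : ∀ a b c d → a * b * (c * d) ≡ a * c * (b * d)
    lemma = solve-∀

  divisors : List ℕ
  divisors = filter (ℕ∣._∣? n) (map suc (upTo n))

  divisor-∈ : ∀ {g} → g ∣ n → g ∈ divisors
  divisor-∈ {zero}  g∣n = contradiction refl (≢-nonZero⁻¹ 0 {{quotient-nonZero g∣n}})
  divisor-∈ {suc g} g∣n = ∈-filter⁺ (ℕ∣._∣? n) (∈-map⁺ suc (∈-upTo⁺ (∣⇒≤ g∣n))) g∣n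

  -- Dominates gcd(x - y, n) - 1, where the gcd runs over all coordinates and n: it is one of the summation indices.
  excess : ∀ {d} → Vec (Fin n) d → Vec (Fin n) d → ℕ
  excess x y = ∑[ g ∈ divisors ] (𝟙 (1 <? g) * (g * 𝟙 (congruent? g x y)))

  -- Equality of the dot products makes n divide z·(x - y), so `congruence-count` applies to the
  -- coordinates of x - y with c = 0. The g it returns is absorbed by `1 + excess x y`.
  collision-count : ∀ {d} (x y : Vec (Fin n) d) →
    n * ∑[ z ∈ points d ] 𝟙 (dot n z x ≟ dot n z y) ≤ n ^ d * (1 + excess x y)
  collision-count {d} x y with g , g∣n , g∣ , count ← congruence-count (x ⊖ y) = begin
    n * ∑[ z ∈ points d ] 𝟙 (dot n z x ≟ dot n z y)
      ≤⟨ *-monoʳ-≤ n (∑-mono (points d) (λ z → 𝟙-mono (λ eq → subst (+ n ∣ℤ_) (sym (ℤ.+-identityˡ _)) (dot-≡⇒∣ z x y eq))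
           (dot n z x ≟ dot n z y) (+ n ∣? (0ℤ ℤ.+ pairing z (x ⊖ y))))) ⟩
    n * ∑[ z ∈ points d ] 𝟙 (+ n ∣? (0ℤ ℤ.+ pairing z (x ⊖ y)))
      ≤⟨ count 0ℤ ⟩
    n ^ d * g * 𝟙 (+ g ∣? 0ℤ)
      ≤⟨ *-monoʳ-≤ (n ^ d * g) (𝟙≤1 (+ g ∣? 0ℤ)) ⟩
    n ^ d * g * 1
      ≡⟨ *-identityʳ _ ⟩
    n ^ d * g
      ≤⟨ *-monoʳ-≤ (n ^ d) g≤ ⟩
    n ^ d * (1 + excess x y) ∎
    where
    open ≤-Reasoning
    congruent : ∀ {d} (x y : Vec (Fin n) d) → VA.All (+ g ∣ℤ_) (x ⊖ y) → Congruent g x y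
    congruent []      []      []       = []
    congruent (a ∷ x) (b ∷ y) (p ∷ ps) = p ∷ congruent x y ps
    term = λ g → 𝟙 (1 <? g) * (g * 𝟙 (congruent? g x y))
    g≤ : g ≤ 1 + excess x y
    g≤ with 1 <? g
    ... | no  ¬1<g = ≤-trans (≮⇒≥ ¬1<g) (s≤s z≤n)
    ... | yes 1<g  = m≤n⇒m≤1+n (begin
      g                                           ≡⟨ trans (*-identityˡ (g * 1)) (*-identityʳ g) ⟨
      1 * (g * 1)                                 ≡⟨ cong₂ (λ i j → i * (g * j)) (𝟙-yes (1 <? g) 1<g) (𝟙-yes (congruent? g x y) (congruent x y g∣)) ⟨
      term g                                      ≤⟨ ∑-∈-≤ term (divisor-∈ g∣n) ⟩
      excess x y                                  ∎)

_≟V_ : ∀ {n d} (x y : Vec (Fin n) d) → Dec (x ≡ y)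
_≟V_ = VP.≡-dec _≟F_

module SecondMoment {n : ℕ} .{{n≢0 : NonZero n}} {d : ℕ} (E : List (Vec (Fin n) (suc d))) (E! : Unique E) where

  e = length E
  -- The dimension is `suc d` here, so this is the power γ(n)ᵈ⁻¹ of the theorem.
  G = γ n ^ d

  -- A divisor g > 1 contributes g times the size of a residue class modulo g. Since γ(n) ≤ g, the
  -- factor `G` is at most gᵈ and completes g to gᵈ⁺¹, which `residue-class-count` absorbs. Each of
  -- the τ(n) divisors thus costs at most nᵈ⁺¹.
  ∑-excess : ∀ y → G * ∑[ x ∈ E ] excess x y ≤ τ n * n ^ suc d
  ∑-excess y = begin
    G * ∑[ x ∈ E ] excess x y
      ≡⟨ cong (G *_) (∑-swap E divisors _) ⟩
    G * ∑[ g ∈ divisors ] ∑[ x ∈ E ] (𝟙 (1 <? g) * (g * 𝟙 (congruent? g x y)))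
      ≡⟨ ∑-*ˡ divisors G _ ⟨
    ∑[ g ∈ divisors ] (G * ∑[ x ∈ E ] (𝟙 (1 <? g) * (g * 𝟙 (congruent? g x y))))
      ≤⟨ ∑-mono-∈ divisors (λ g∈ → per-divisor (proj₂ (∈-filter⁻ (ℕ∣._∣? n) {xs = map suc (upTo n)} g∈))) ⟩
    ∑[ g ∈ divisors ] (n ^ suc d)
      ≡⟨ ∑-const divisors (n ^ suc d) ⟩
    τ n * n ^ suc d ∎
    where
    open ≤-Reasoning
    per-divisor : ∀ {g} → g ∣ n → G * ∑[ x ∈ E ] (𝟙 (1 <? g) * (g * 𝟙 (congruent? g x y))) ≤ n ^ suc d
    per-divisor {g} g∣n with 1 <? g
    ... | no  _   = ≤-trans (≤-reflexive (trans (cong (G *_) (trans (∑-const E 0) (*-zeroʳ e))) (*-zeroʳ G))) z≤n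
    ... | yes 1<g = begin
      G * ∑[ x ∈ E ] (1 * (g * 𝟙 (congruent? g x y)))
        ≡⟨ cong (G *_) (trans (∑-cong E (λ x → *-identityˡ (g * 𝟙 (congruent? g x y)))) (∑-*ˡ E g _)) ⟩
      G * (g * ∑[ x ∈ E ] 𝟙 (congruent? g x y))
        ≡⟨ lemma G g _ ⟩
      g * G * ∑[ x ∈ E ] 𝟙 (congruent? g x y)
        ≤⟨ *-mono-≤ (*-monoʳ-≤ g (^-monoˡ-≤ d (γ≤divisor n 1<g g∣n)))
                    (∑-inj-≤ _≟V_ E! id id ∈-points (λ x → 𝟙 (congruent? g x y))) ⟩
      g ^ suc d * ∑[ x ∈ points (suc d) ] 𝟙 (congruent? g x y)
        ≤⟨ residue-class-count g∣n y ⟩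
      n ^ suc d ∎
      where
      lemma : ∀ a b c → a * (b * c) ≡ b * a * c
      lemma = solve-∀

  ν : Vec (Fin n) (suc d) → ℕ → ℕ
  ν z t = ∑[ y ∈ E ] 𝟙 (dot n z y ≟ t)

  ∑-ν : ∀ z → ∑[ t ∈ upTo n ] ν z t ≡ e
  ∑-ν z = ∑-fibres _≟_ (upTo⁺ n) E (dot n z) (λ {y} _ → ∈-upTo⁺ (dot< z y))

  ∑-ν² : ∀ z → ∑[ t ∈ upTo n ] (ν z t * ν z t) ≡ ∑[ y ∈ E ] ∑[ x ∈ E ] 𝟙 (dot n z x ≟ dot n z y)
  ∑-ν² z = ∑-fibres² _≟_ (upTo⁺ n) E (dot n z) (λ {y} _ → ∈-upTo⁺ (dot< z y))

  -- The truncated difference n ν ∸ e only sees fibres larger than average, which is all an upper bound on moments needs.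
  dev² : Vec (Fin n) (suc d) → ℕ → ℕ
  dev² z t = (n * ν z t ∸ e) * (n * ν z t ∸ e)

  S = ∑[ z ∈ points (suc d) ] ∑[ t ∈ upTo n ] (ν z t * ν z t)
  V = ∑[ z ∈ points (suc d) ] ∑[ t ∈ upTo n ] dev² z t

  -- `S` counts triples (z, x, y) with x, y in `E` and z·x = z·y. Counting z first, the 1 in
  -- `collision-count` yields the main term e², and `∑-excess` bounds the rest for each y.
  S-bound : G * (n * S) ≤ n ^ suc d * (e * (G * e + τ n * n ^ suc d))
  S-bound = begin
    G * (n * S)
      ≡⟨ cong (λ s → G * (n * s)) (∑-cong (points (suc d)) ∑-ν²) ⟩
    G * (n * ∑[ z ∈ points (suc d) ] ∑[ y ∈ E ] ∑[ x ∈ E ] 𝟙 (dot n z x ≟ dot n z y))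
      ≡⟨ cong (λ s → G * (n * s)) (trans (∑-swap (points (suc d)) E _) (∑-cong E (λ y → ∑-swap (points (suc d)) E _))) ⟩
    G * (n * ∑[ y ∈ E ] ∑[ x ∈ E ] ∑[ z ∈ points (suc d) ] 𝟙 (dot n z x ≟ dot n z y))
      ≡⟨ cong (G *_) (trans (sym (∑-*ˡ E n _)) (∑-cong E (λ y → sym (∑-*ˡ E n _)))) ⟩
    G * ∑[ y ∈ E ] ∑[ x ∈ E ] (n * ∑[ z ∈ points (suc d) ] 𝟙 (dot n z x ≟ dot n z y))
      ≤⟨ *-monoʳ-≤ G (∑-mono E (λ y → ∑-mono E (λ x → collision-count x y))) ⟩
    G * ∑[ y ∈ E ] ∑[ x ∈ E ] (n ^ suc d * (1 + excess x y))
      ≡⟨ cong (G *_) (trans (∑-cong E (λ y → trans (∑-*ˡ E (n ^ suc d) _) (cong (n ^ suc d *_)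
           (trans (∑-+ E (λ _ → 1) _) (cong (_+ ∑[ x ∈ E ] excess x y) (sym (length-∑ E))))))) (∑-*ˡ E (n ^ suc d) _)) ⟩
    G * (n ^ suc d * ∑[ y ∈ E ] (e + ∑[ x ∈ E ] excess x y))
      ≡⟨ trans (lemma G (n ^ suc d) _) (cong (n ^ suc d *_) (sym (∑-*ˡ E G _))) ⟩
    n ^ suc d * ∑[ y ∈ E ] (G * (e + ∑[ x ∈ E ] excess x y))
      ≤⟨ *-monoʳ-≤ (n ^ suc d) (∑-mono E (λ y → ≤-trans (≤-reflexive (*-distribˡ-+ G e _)) (+-monoʳ-≤ (G * e) (∑-excess y)))) ⟩
    n ^ suc d * ∑[ y ∈ E ] (G * e + τ n * n ^ suc d)
      ≡⟨ cong (n ^ suc d *_) (∑-const E _) ⟩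
    n ^ suc d * (e * (G * e + τ n * n ^ suc d)) ∎
    where
    open ≤-Reasoning
    lemma : ∀ a b c → a * (b * c) ≡ b * (a * c)
    lemma = solve-∀

  -- As the fibre sizes of each z add up to e, the untruncated squares sum over t to n² Σ ν² - n e².
  -- To avoid subtraction the cross term 2 n e² stays on the left, and one n e² per z is cancelled
  -- at the end.
  variance-expansion : V + n ^ suc d * (n * (e * e)) ≤ n * n * S
  variance-expansion = +-cancelʳ-≤ (n ^ suc d * (n * (e * e))) _ _ (begin
    V + n ^ suc d * (n * (e * e)) + n ^ suc d * (n * (e * e))
      ≡⟨ lemma V (n ^ suc d) (n * (e * e)) ⟩
    V + n ^ suc d * (2 * (n * (e * e)))
      ≡⟨ cong (λ s → V + s) (∑-points-const (suc d) _) ⟨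
    V + ∑[ z ∈ points (suc d) ] (2 * (n * (e * e)))
      ≡⟨ ∑-+ (points (suc d)) _ _ ⟨
    ∑[ z ∈ points (suc d) ] (∑[ t ∈ upTo n ] dev² z t + 2 * (n * (e * e)))
      ≤⟨ ∑-mono (points (suc d)) pointwise ⟩
    ∑[ z ∈ points (suc d) ] (n * n * ∑[ t ∈ upTo n ] (ν z t * ν z t) + n * (e * e))
      ≡⟨ trans (∑-+ (points (suc d)) _ _) (cong₂ _+_ (∑-*ˡ (points (suc d)) (n * n) _) (∑-points-const (suc d) _)) ⟩
    n * n * S + n ^ suc d * (n * (e * e)) ∎)
    where
    open ≤-Reasoning
    lemma : ∀ v a b → v + a * b + a * b ≡ v + a * (2 * b)
    lemma = solve-∀
    lemma₂ : ∀ n e → 2 * (n * (e * e)) ≡ 2 * (n * e) * e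
    lemma₂ = solve-∀
    lemma₃ : ∀ n v e → 2 * (n * e) * v ≡ 2 * (n * v * e)
    lemma₃ = solve-∀
    lemma₄ : ∀ n v → n * v * (n * v) ≡ n * n * (v * v)
    lemma₄ = solve-∀
    pointwise : ∀ z → ∑[ t ∈ upTo n ] dev² z t + 2 * (n * (e * e)) ≤ n * n * ∑[ t ∈ upTo n ] (ν z t * ν z t) + n * (e * e)
    pointwise z = begin
      ∑[ t ∈ upTo n ] dev² z t + 2 * (n * (e * e))
        ≡⟨ cong (λ s → ∑[ t ∈ upTo n ] dev² z t + s) (trans (lemma₂ n e) (trans (cong (2 * (n * e) *_) (sym (∑-ν z))) (sym (∑-*ˡ (upTo n) (2 * (n * e)) _)))) ⟩
      ∑[ t ∈ upTo n ] dev² z t + ∑[ t ∈ upTo n ] (2 * (n * e) * ν z t)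
        ≡⟨ ∑-+ (upTo n) _ _ ⟨
      ∑[ t ∈ upTo n ] (dev² z t + 2 * (n * e) * ν z t)
        ≡⟨ ∑-cong (upTo n) (λ t → cong (λ s → dev² z t + s) (lemma₃ n (ν z t) e)) ⟩
      ∑[ t ∈ upTo n ] (dev² z t + 2 * (n * ν z t * e))
        ≤⟨ ∑-mono (upTo n) (λ t → [a∸b]²+2ab≤a²+b² (n * ν z t) e) ⟩
      ∑[ t ∈ upTo n ] (n * ν z t * (n * ν z t) + e * e)
        ≡⟨ trans (∑-+ (upTo n) _ _) (cong₂ _+_
             (trans (∑-cong (upTo n) (λ t → lemma₄ n (ν z t))) (∑-*ˡ (upTo n) (n * n) _))
             (trans (∑-const (upTo n) (e * e)) (cong (_* (e * e)) (length-applyUpTo id n)))) ⟩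
      n * n * ∑[ t ∈ upTo n ] (ν z t * ν z t) + n * (e * e) ∎

  -- The main term of `S-bound` is exactly the e² term of `variance-expansion`; cancelling it leaves
  -- the contribution of the excess alone.
  variance-bound : G * V ≤ n * (n ^ suc d * (e * (τ n * n ^ suc d)))
  variance-bound = +-cancelʳ-≤ (G * (n ^ suc d * (n * (e * e)))) _ _ (begin
    G * V + G * (n ^ suc d * (n * (e * e)))      ≡⟨ *-distribˡ-+ G V _ ⟨
    G * (V + n ^ suc d * (n * (e * e)))          ≤⟨ *-monoʳ-≤ G variance-expansion ⟩
    G * (n * n * S)                              ≡⟨ lemma₁ G n S ⟩
    n * (G * (n * S))                            ≤⟨ *-monoʳ-≤ n S-bound ⟩
    n * (n ^ suc d * (e * (G * e + τ n * n ^ suc d)))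
      ≡⟨ lemma₂ n (n ^ suc d) e G (τ n * n ^ suc d) ⟩
    n * (n ^ suc d * (e * (τ n * n ^ suc d))) + G * (n ^ suc d * (n * (e * e))) ∎)
    where
    open ≤-Reasoning
    lemma₁ : ∀ a n s → a * (n * n * s) ≡ n * (a * (n * s))
    lemma₁ = solve-∀
    lemma₂ : ∀ n x e a t → n * (x * (e * (a * e + t))) ≡ n * (x * (e * t)) + a * (x * (n * (e * e)))
    lemma₂ = solve-∀

-- Moments and the star sum

^-distribʳ-* : ∀ a b k → (a * b) ^ k ≡ a ^ k * b ^ k
^-distribʳ-* a b zero    = refl
^-distribʳ-* a b (suc k) = trans (cong (a * b *_) (^-distribʳ-* a b k)) (lemma a b (a ^ k) (b ^ k))
  where
  lemma : ∀ a b x y → a * b * (x * y) ≡ a * x * (b * y)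
  lemma = solve-∀

-- Either a ≤ 2 e, or a ≤ 2 (a - e). In the second case two factors a become 2 (a - e), whence the
-- 4, and the other i factors are bounded by b.
power-split : ∀ {a b} e i → a ≤ b → a ^ (2 + i) ≤ (2 * e) ^ (2 + i) + 4 * (b ^ i * ((a ∸ e) * (a ∸ e)))
power-split {a} {b} e i a≤b with ≤-total a (2 * e)
... | inj₁ a≤2e = ≤-trans (^-monoˡ-≤ (2 + i) a≤2e) (m≤m+n ((2 * e) ^ (2 + i)) _)
... | inj₂ 2e≤a = begin
  a ^ (2 + i)                                              ≤⟨ *-mono-≤ a≤2[a∸e] (*-mono-≤ a≤2[a∸e] (^-monoˡ-≤ i a≤b)) ⟩
  2 * (a ∸ e) * (2 * (a ∸ e) * b ^ i)                      ≡⟨ lemma (a ∸ e) (b ^ i) ⟩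
  4 * (b ^ i * ((a ∸ e) * (a ∸ e)))                        ≤⟨ m≤n+m _ ((2 * e) ^ (2 + i)) ⟩
  (2 * e) ^ (2 + i) + 4 * (b ^ i * ((a ∸ e) * (a ∸ e)))    ∎
  where
  open ≤-Reasoning
  lemma : ∀ c x → 2 * c * (2 * c * x) ≡ 4 * (x * (c * c))
  lemma = solve-∀
  a≤2[a∸e] : a ≤ 2 * (a ∸ e)
  a≤2[a∸e] with c , refl ← m≤n⇒∃[o]m+o≡n 2e≤a = begin
    2 * e + c               ≤⟨ m≤m+n _ c ⟩
    2 * e + c + c           ≡⟨ lemma₁ e c ⟩
    2 * (e + c)             ≡⟨ cong (2 *_) (m+n∸m≡n e (e + c)) ⟨
    2 * (e + (e + c) ∸ e)   ≡⟨ cong (λ s → 2 * (s ∸ e)) (lemma₂ e c) ⟩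
    2 * (2 * e + c ∸ e)     ∎
    where
    lemma₁ : ∀ e c → 2 * e + c + c ≡ 2 * (e + c)
    lemma₁ = solve-∀
    lemma₂ : ∀ e c → e + (e + c) ≡ 2 * e + c
    lemma₂ = solve-∀

-- Subtraction of vectors modulo n

module _ {n : ℕ} .{{n≢0 : NonZero n}} where

  infixl 6 _⊟_

  -- Adding n - b in place of subtracting b keeps the computation in ℕ.
  _⊟_ : ∀ {d} → Vec (Fin n) d → Vec (Fin n) d → Vec (Fin n) d
  _⊟_ = V.zipWith (λ a b → F.fromℕ< (m%n<n (toℕ a + (n ∸ toℕ b)) n))

  ⊟-coordinate : ∀ (a b : Fin n) → + n ∣ℤ (+ toℕ (F.fromℕ< (m%n<n (toℕ a + (n ∸ toℕ b)) n)) ℤ.- (+ toℕ a ℤ.- + toℕ b))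
  ⊟-coordinate a b = subst (+ n ∣ℤ_) eq
    -- The extra summand n compensates the n inside `n ∸ toℕ b`.
    (ℤ∣.∣m∣n⇒∣m+n (%-≡⇒∣ (s % n) s (m%n%n≡m%n s n)) ℤ∣.∣-refl)
    where
    open ≡-Reasoning
    s = toℕ a + (n ∸ toℕ b)
    lemma : ∀ r a n b → r ℤ.- (a ℤ.+ (n ℤ.- b)) ℤ.+ n ≡ r ℤ.- (a ℤ.- b)
    lemma = ℤ.solve-∀
    eq : + (s % n) ℤ.- + s ℤ.+ + n ≡ + toℕ (F.fromℕ< (m%n<n s n)) ℤ.- (+ toℕ a ℤ.- + toℕ b)
    eq = begin
      + (s % n) ℤ.- (+ toℕ a ℤ.+ + (n ∸ toℕ b)) ℤ.+ + n
        ≡⟨ cong (λ i → + (s % n) ℤ.- (+ toℕ a ℤ.+ i) ℤ.+ + n) (trans (sym (ℤ.⊖-≥ (<⇒≤ (toℕ<n b)))) (sym (ℤ.[+m]-[+n]≡m⊖n n (toℕ b)))) ⟩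
      + (s % n) ℤ.- (+ toℕ a ℤ.+ (+ n ℤ.- + toℕ b)) ℤ.+ + n
        ≡⟨ lemma (+ (s % n)) (+ toℕ a) (+ n) (+ toℕ b) ⟩
      + (s % n) ℤ.- (+ toℕ a ℤ.- + toℕ b)
        ≡⟨ cong (λ r → + r ℤ.- (+ toℕ a ℤ.- + toℕ b)) (toℕ-fromℕ< (m%n<n s n)) ⟨
      + toℕ (F.fromℕ< (m%n<n s n)) ℤ.- (+ toℕ a ℤ.- + toℕ b) ∎

  -- Makes translation by z admissible in `∑-inj-≤`. Equal differences give heads congruent modulo
  -- n, and both heads lie below n.
  ⊟-injectiveˡ : ∀ {d} (z : Vec (Fin n) d) {x y} → x ⊟ z ≡ y ⊟ z → x ≡ y
  ⊟-injectiveˡ []      {[]}    {[]}    _  = refl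
  ⊟-injectiveˡ (c ∷ z) {a ∷ x} {b ∷ y} eq = cong₂ _∷_
    (toℕ-injective (∣-<⇒≡ (toℕ<n a) (toℕ<n b) (subst (+ n ∣ℤ_) (lemma (+ toℕ (V.head ((b ∷ y) ⊟ (c ∷ z)))) (+ toℕ a) (+ toℕ b) (+ toℕ c))
      (ℤ∣.∣m∣n⇒∣m-n (⊟-coordinate b c) (subst (λ v → + n ∣ℤ (+ toℕ (V.head v) ℤ.- (+ toℕ a ℤ.- + toℕ c))) eq (⊟-coordinate a c))))))
    (⊟-injectiveˡ z (cong V.tail eq))
    where
    lemma : ∀ s a b c → (s ℤ.- (b ℤ.- c)) ℤ.- (s ℤ.- (a ℤ.- c)) ≡ a ℤ.- b
    lemma = ℤ.solve-∀

  dotℕ-⊟ : ∀ {d} (x z y : Vec (Fin n) d) → + n ∣ℤ (+ dotℕ (x ⊟ z) y ℤ.- (+ dotℕ x y ℤ.- + dotℕ z y))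
  dotℕ-⊟ []      []      []      = dividesℤ 0ℤ refl
  dotℕ-⊟ (a ∷ x) (c ∷ z) (b ∷ y) = subst (+ n ∣ℤ_) eq
    (ℤ∣.∣m∣n⇒∣m+n (ℤ∣.∣m⇒∣m*n (+ toℕ b) (⊟-coordinate a c)) (dotℕ-⊟ x z y))
    where
    open ≡-Reasoning
    s = V.head ((a ∷ x) ⊟ (c ∷ z))
    lemma : ∀ s a c b u v w → (s ℤ.- (a ℤ.- c)) ℤ.* b ℤ.+ (u ℤ.- (v ℤ.- w)) ≡
            (s ℤ.* b ℤ.+ u) ℤ.- ((a ℤ.* b ℤ.+ v) ℤ.- (c ℤ.* b ℤ.+ w))
    lemma = ℤ.solve-∀
    head-* : ∀ i u → + toℕ i ℤ.* + toℕ b ℤ.+ + u ≡ + (toℕ i * toℕ b + u)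
    head-* i u = cong (ℤ._+ + u) (sym (ℤ.pos-* (toℕ i) (toℕ b)))
    eq : (+ toℕ s ℤ.- (+ toℕ a ℤ.- + toℕ c)) ℤ.* + toℕ b ℤ.+ (+ dotℕ (x ⊟ z) y ℤ.- (+ dotℕ x y ℤ.- + dotℕ z y)) ≡
         + dotℕ ((a ∷ x) ⊟ (c ∷ z)) (b ∷ y) ℤ.- (+ dotℕ (a ∷ x) (b ∷ y) ℤ.- + dotℕ (c ∷ z) (b ∷ y))
    eq = trans (lemma (+ toℕ s) (+ toℕ a) (+ toℕ c) (+ toℕ b) (+ dotℕ (x ⊟ z) y) (+ dotℕ x y) (+ dotℕ z y))
      (cong₂ ℤ._-_ (head-* s (dotℕ (x ⊟ z) y)) (cong₂ ℤ._-_ (head-* a (dotℕ x y)) (head-* c (dotℕ z y))))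

  dot-⊟ : ∀ {d} (x z y : Vec (Fin n) d) → dot n x y ≡ dot n z y → dot n (x ⊟ z) y ≡ 0
  dot-⊟ x z y eq = trans (dot-% (x ⊟ z) y) (trans (∣-≡⇒≡ (subst (+ n ∣ℤ_) (lemma (+ dotℕ (x ⊟ z) y) (+ dotℕ x y ℤ.- + dotℕ z y))
    (ℤ∣.∣m∣n⇒∣m+n (dotℕ-⊟ x z y) (%-≡⇒∣ (dotℕ x y) (dotℕ z y) (trans (sym (dot-% x y)) (trans eq (dot-% z y))))))) (m<n⇒m%n≡m (>-nonZero⁻¹ n)))
    where
    lemma : ∀ a b → a ℤ.- b ℤ.+ b ≡ a ℤ.- 0ℤ
    lemma = ℤ.solve-∀

-- Moments of the coincidence counts

module StarMoments {n : ℕ} .{{n≢0 : NonZero n}} {d : ℕ} (E : List (Vec (Fin n) (suc d))) (E! : Unique E) where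

  open SecondMoment E E!

  N : Vec (Fin n) (suc d) → Vec (Fin n) (suc d) → ℕ
  N x z = ∑[ y ∈ E ] 𝟙 (dot n x y ≟ dot n z y)

  M : ℕ → ℕ
  M k = ∑[ z ∈ E ] ∑[ x ∈ E ] (N x z ^ k)

  -- The entries of the tuple are chosen independently, and each must satisfy x·y = z·y, so the
  -- count splits into k factors `N x z`.
  coincidences : ∀ k x z → ∑[ ys ∈ tuples E k ] 𝟙 (VP.≡-dec _≟_ (V.map (dot n x) ys) (V.map (dot n z) ys)) ≤ N x z ^ k
  coincidences zero    x z = ≤-refl
  coincidences (suc k) x z = begin
    ∑[ ys ∈ tuples E (suc k) ] 𝟙 (VP.≡-dec _≟_ (V.map (dot n x) ys) (V.map (dot n z) ys))
      ≡⟨ ∑-tuples-suc E k _ ⟩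
    ∑[ y ∈ E ] ∑[ ys ∈ tuples E k ] 𝟙 (VP.≡-dec _≟_ (dot n x y ∷ V.map (dot n x) ys) (dot n z y ∷ V.map (dot n z) ys))
      ≤⟨ ∑-mono E (λ y → ∑-mono (tuples E k) (λ ys → 𝟙-mono-* VP.∷-injective
           (VP.≡-dec _≟_ (dot n x y ∷ V.map (dot n x) ys) (dot n z y ∷ V.map (dot n z) ys)) (dot n x y ≟ dot n z y)
           (VP.≡-dec _≟_ (V.map (dot n x) ys) (V.map (dot n z) ys)))) ⟩
    ∑[ y ∈ E ] ∑[ ys ∈ tuples E k ] (𝟙 (dot n x y ≟ dot n z y) * 𝟙 (VP.≡-dec _≟_ (V.map (dot n x) ys) (V.map (dot n z) ys)))
      ≡⟨ ∑-*-∑ E (tuples E k) _ _ ⟨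
    N x z * ∑[ ys ∈ tuples E k ] 𝟙 (VP.≡-dec _≟_ (V.map (dot n x) ys) (V.map (dot n z) ys))
      ≤⟨ *-monoʳ-≤ (N x z) (coincidences k x z) ⟩
    N x z ^ suc k ∎
    where open ≤-Reasoning

  -- Sum `image-size` over all k-tuples; exchanging sums brings the colliding pairs under
  -- `coincidences`. The weights l and m stay free until `starSum-bound`.
  starSum-lower : ∀ k l m → e ^ k * (2 * (l * m) * e) ≤ l * l * starSum n k E + m * m * M k
  starSum-lower k l m = begin
    e ^ k * (2 * (l * m) * e)
      ≡⟨ ∑-tuples-const E k _ ⟨
    ∑[ ys ∈ tuples E k ] (2 * (l * m) * e)
      ≤⟨ ∑-mono (tuples E k) (λ ys → image-size (VP.≡-dec _≟_) E (λ x → V.map (dot n x) ys) l m) ⟩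
    ∑[ ys ∈ tuples E k ] (l * l * length (Pi n ys E) + m * m * pairs ys)
      ≡⟨ trans (∑-+ (tuples E k) _ _) (cong₂ _+_ (∑-*ˡ (tuples E k) (l * l) _) (∑-*ˡ (tuples E k) (m * m) _)) ⟩
    l * l * starSum n k E + m * m * ∑ (tuples E k) pairs
      ≤⟨ +-monoʳ-≤ (l * l * starSum n k E) (*-monoʳ-≤ (m * m) ∑-pairs≤M) ⟩
    l * l * starSum n k E + m * m * M k ∎
    where
    open ≤-Reasoning
    pairs : Vec (Vec (Fin n) (suc d)) k → ℕ
    pairs ys = ∑[ z ∈ E ] ∑[ x ∈ E ] 𝟙 (VP.≡-dec _≟_ (V.map (dot n x) ys) (V.map (dot n z) ys))
    ∑-pairs≤M : ∑ (tuples E k) pairs ≤ M k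
    ∑-pairs≤M = ≤-trans (≤-reflexive (trans (∑-swap (tuples E k) E _) (∑-cong E (λ z → ∑-swap (tuples E k) E _))))
                  (∑-mono E (λ z → ∑-mono E (λ x → coincidences k x z)))

  N≤e : ∀ x z → N x z ≤ e
  N≤e x z = ≤-trans (∑-mono E (λ y → 𝟙≤1 (dot n x y ≟ dot n z y))) (≤-reflexive (sym (length-∑ E)))

  -- Solutions of x·y = z·y are solutions of (x - z)·y = 0, so the fibres over t = 0 alone suffice.
  ∑-deviation≤V : ∀ z → ∑[ x ∈ E ] ((n * N x z ∸ e) * (n * N x z ∸ e)) ≤ V
  ∑-deviation≤V z = begin
    ∑[ x ∈ E ] ((n * N x z ∸ e) * (n * N x z ∸ e))
      ≤⟨ ∑-mono E (λ x → let le = ∸-monoˡ-≤ e (*-monoʳ-≤ n (∑-mono E (λ y → 𝟙-mono (dot-⊟ x z y) (dot n x y ≟ dot n z y) (dot n (x ⊟ z) y ≟ 0)))) in *-mono-≤ le le) ⟩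
    ∑[ x ∈ E ] dev² (x ⊟ z) 0
      ≤⟨ ∑-inj-≤ _≟V_ E! (_⊟ z) (⊟-injectiveˡ z) (λ x → ∈-points (x ⊟ z)) (λ w → dev² w 0) ⟩
    ∑[ w ∈ points (suc d) ] dev² w 0
      ≤⟨ ∑-mono (points (suc d)) (λ w → ∑-∈-≤ (dev² w) (∈-upTo⁺ (>-nonZero⁻¹ n))) ⟩
    V ∎
    where open ≤-Reasoning

  -- The exponent 1 is too small for `power-split`, so `M 1` is turned into a sum of squares: for
  -- fixed y, the pairs with x·y = z·y are the collisions of x ↦ y·x.
  M₁≡∑ν² : M 1 ≡ ∑[ y ∈ E ] ∑[ t ∈ upTo n ] (ν y t * ν y t)
  M₁≡∑ν² = begin
    M 1
      ≡⟨ ∑-cong E (λ z → ∑-cong E (λ x → *-identityʳ (N x z))) ⟩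
    ∑[ z ∈ E ] ∑[ x ∈ E ] N x z
      ≡⟨ trans (∑-cong E (λ z → ∑-swap E E _)) (∑-swap E E _) ⟩
    ∑[ y ∈ E ] ∑[ z ∈ E ] ∑[ x ∈ E ] 𝟙 (dot n x y ≟ dot n z y)
      ≡⟨ ∑-cong E (λ y → ∑-cong E (λ z → ∑-cong E (λ x → cong₂ (λ a b → 𝟙 (a ≟ b)) (dot-comm x y) (dot-comm z y)))) ⟩
    ∑[ y ∈ E ] ∑[ z ∈ E ] ∑[ x ∈ E ] 𝟙 (dot n y x ≟ dot n y z)
      ≡⟨ ∑-cong E ∑-ν² ⟨
    ∑[ y ∈ E ] ∑[ t ∈ upTo n ] (ν y t * ν y t) ∎
    where open ≡-Reasoning

  module _ {j : ℕ} (large : τ n * n ^ (2 * suc d + suc j ∸ 1) ≤ e * e * G) where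

    -- `large` is the squared size condition for k = j + 1. Once `variance-bound` is multiplied by
    -- nʲ, its right side contains precisely the quantity that `large` bounds by e² `G`, and `G`
    -- cancels.
    scaled-variance : n ^ j * V ≤ n * (e * (e * e))
    scaled-variance = *-cancelˡ-≤ G {{m^n≢0 (γ n) d {{γ-nonZero n}}}} (begin
      G * (n ^ j * V)
        ≡⟨ lemma₁ G (n ^ j) V ⟩
      n ^ j * (G * V)
        ≤⟨ *-monoʳ-≤ (n ^ j) variance-bound ⟩
      n ^ j * (n * (n ^ suc d * (e * (τ n * n ^ suc d))))
        ≡⟨ lemma₂ (n ^ j) n (n ^ suc d) e (τ n) ⟩
      n * e * (τ n * (n ^ suc d * (n ^ suc d * n ^ j)))
        ≡⟨ cong (λ s → n * e * (τ n * s)) exponent ⟨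
      n * e * (τ n * n ^ (2 * suc d + suc j ∸ 1))
        ≤⟨ *-monoʳ-≤ (n * e) large ⟩
      n * e * (e * e * G)
        ≡⟨ lemma₃ n e G ⟩
      G * (n * (e * (e * e))) ∎)
      where
      open ≤-Reasoning
      lemma₁ : ∀ a b c → a * (b * c) ≡ b * (a * c)
      lemma₁ = solve-∀
      lemma₂ : ∀ y n x e t → y * (n * (x * (e * (t * x)))) ≡ n * e * (t * (x * (x * y)))
      lemma₂ = solve-∀
      lemma₃ : ∀ n e g → n * e * (e * e * g) ≡ g * (n * (e * (e * e)))
      lemma₃ = solve-∀
      lemma₄ : ∀ s j → 2 * s + suc j ≡ suc (s + (s + j))
      lemma₄ = solve-∀
      exponent : n ^ (2 * suc d + suc j ∸ 1) ≡ n ^ suc d * (n ^ suc d * n ^ j)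
      -- The exponent before `∸ 1` is a successor, so the subtraction is exact and leaves (d + 1) +
      -- (d + 1) + j.
      exponent = trans (cong (λ s → n ^ (s ∸ 1)) (lemma₄ (suc d) j))
        (trans (^-distribˡ-+-* n (suc d) (suc d + j)) (cong (n ^ suc d *_) (^-distribˡ-+-* n (suc d) j)))

  -- The case k = 1 produces 4 + 4 = 2¹ + 6, and the cases k ≥ 2 produce 2ᵏ + 4; this expression
  -- covers both.
  momentConstant : ℕ → ℕ
  momentConstant k = 2 ^ k + 6

  -- `power-split` separates values up to 2 e, which give the main term, from larger ones, which
  -- `scaled-variance` controls. It is applied to n ν over all t when k = 1, and to n `N x z` when k
  -- ≥ 2.
  moment-bound : ∀ j → τ n * n ^ (2 * suc d + suc j ∸ 1) ≤ e * e * G → n ^ suc j * M (suc j) ≤ momentConstant (suc j) * e ^ (2 + suc j)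
  -- The extra factor n supplies the n² that turns ν² into the square of n ν.
  moment-bound zero large = *-cancelˡ-≤ n (begin
    n * (n ^ 1 * M 1)
      ≡⟨ trans (lemma₁ n (M 1)) (cong (n * n *_) M₁≡∑ν²) ⟩
    n * n * ∑[ y ∈ E ] ∑[ t ∈ upTo n ] (ν y t * ν y t)
      ≡⟨ trans (sym (∑-*ˡ E (n * n) _)) (∑-cong E (λ y → sym (∑-*ˡ (upTo n) (n * n) _))) ⟩
    ∑[ y ∈ E ] ∑[ t ∈ upTo n ] (n * n * (ν y t * ν y t))
      ≤⟨ ∑-mono E (λ y → ∑-mono (upTo n) (λ t → pointwise (ν y t))) ⟩
    ∑[ y ∈ E ] ∑[ t ∈ upTo n ] (4 * (e * e) + 4 * dev² y t)
      ≡⟨ ∑-cong E (λ y → trans (∑-+ (upTo n) _ _) (cong₂ _+_ (trans (∑-const (upTo n) _) (cong (_* (4 * (e * e))) (length-applyUpTo id n))) (∑-*ˡ (upTo n) 4 _))) ⟩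
    ∑[ y ∈ E ] (n * (4 * (e * e)) + 4 * ∑[ t ∈ upTo n ] dev² y t)
      ≡⟨ trans (∑-+ E _ _) (cong₂ _+_ (∑-const E _) (∑-*ˡ E 4 _)) ⟩
    e * (n * (4 * (e * e))) + 4 * ∑[ y ∈ E ] ∑[ t ∈ upTo n ] dev² y t
      ≤⟨ +-monoʳ-≤ (e * (n * (4 * (e * e)))) (*-monoʳ-≤ 4 (begin
           ∑[ y ∈ E ] ∑[ t ∈ upTo n ] dev² y t  ≤⟨ ∑-inj-≤ _≟V_ E! id id ∈-points (λ y → ∑[ t ∈ upTo n ] dev² y t) ⟩
           V                                    ≡⟨ *-identityˡ V ⟨
           1 * V                                ≤⟨ scaled-variance {0} large ⟩
           n * (e * (e * e))                    ∎)) ⟩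
    e * (n * (4 * (e * e))) + 4 * (n * (e * (e * e)))
      ≡⟨ lemma₂ n e ⟩
    n * (momentConstant 1 * e ^ 3) ∎)
    where
    open ≤-Reasoning
    lemma₁ : ∀ n m → n * (n * 1 * m) ≡ n * n * m
    lemma₁ = solve-∀
    lemma₂ : ∀ n e → e * (n * (4 * (e * e))) + 4 * (n * (e * (e * e))) ≡ n * (8 * (e * (e * (e * 1))))
    lemma₂ = solve-∀
    lemma₃ : ∀ n v → n * n * (v * v) ≡ n * v * (n * v * 1)
    lemma₃ = solve-∀
    lemma₄ : ∀ e x → 2 * e * (2 * e * 1) + 4 * (1 * x) ≡ 4 * (e * e) + 4 * x
    lemma₄ = solve-∀
    pointwise : ∀ v → n * n * (v * v) ≤ 4 * (e * e) + 4 * ((n * v ∸ e) * (n * v ∸ e))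
    pointwise v = ≤-trans (≤-reflexive (lemma₃ n v)) (≤-trans (power-split e 0 (≤-refl {n * v})) (≤-reflexive (lemma₄ e ((n * v ∸ e) * (n * v ∸ e)))))
  moment-bound (suc i) large = begin
    n ^ k * M k
      ≡⟨ trans (sym (∑-*ˡ E (n ^ k) _)) (∑-cong E (λ z → sym (∑-*ˡ E (n ^ k) _))) ⟩
    ∑[ z ∈ E ] ∑[ x ∈ E ] (n ^ k * N x z ^ k)
      ≤⟨ ∑-mono E (λ z → ∑-mono E (λ x → ≤-trans (≤-reflexive (sym (^-distribʳ-* n (N x z) k))) (power-split e i (*-monoʳ-≤ n (N≤e x z))))) ⟩
    ∑[ z ∈ E ] ∑[ x ∈ E ] ((2 * e) ^ k + 4 * ((n * e) ^ i * δ x z))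
      ≡⟨ ∑-cong E (λ z → trans (∑-+ E _ _) (cong₂ _+_ (∑-const E _) (trans (∑-*ˡ E 4 _) (cong (4 *_) (∑-*ˡ E ((n * e) ^ i) _))))) ⟩
    ∑[ z ∈ E ] (e * (2 * e) ^ k + 4 * ((n * e) ^ i * ∑[ x ∈ E ] δ x z))
      ≤⟨ ∑-mono E (λ z → +-monoʳ-≤ (e * (2 * e) ^ k) (*-monoʳ-≤ 4 (*-monoʳ-≤ ((n * e) ^ i) (∑-deviation≤V z)))) ⟩
    ∑[ z ∈ E ] (e * (2 * e) ^ k + 4 * ((n * e) ^ i * V))
      ≡⟨ ∑-const E _ ⟩
    e * (e * (2 * e) ^ k + 4 * ((n * e) ^ i * V))
      ≡⟨ cong₂ (λ a b → e * (e * a + 4 * (b * V))) (^-distribʳ-* 2 e k) (^-distribʳ-* n e i) ⟩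
    e * (e * (2 ^ k * e ^ k) + 4 * (n ^ i * e ^ i * V))
      ≡⟨ lemma₁ e (2 ^ k * e ^ k) (n ^ i) (e ^ i) V ⟩
    e * (e * (2 ^ k * e ^ k) + 4 * (e ^ i * (n ^ i * V)))
      -- Here j = i + 1, so `scaled-variance` has nⁱ⁺¹ on the left; cancelling one n leaves nⁱ `V` ≤
      -- e³.
      ≤⟨ *-monoʳ-≤ e (+-monoʳ-≤ (e * (2 ^ k * e ^ k)) (*-monoʳ-≤ 4 (*-monoʳ-≤ (e ^ i)
           (*-cancelˡ-≤ n (≤-trans (≤-reflexive (sym (*-assoc n (n ^ i) V))) (scaled-variance {suc i} large)))))) ⟩
    e * (e * (2 ^ k * e ^ k) + 4 * (e ^ i * (e * (e * e))))
      ≡⟨ lemma₂ e (2 ^ k) (e ^ i) ⟩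
    (2 ^ k + 4) * e ^ (2 + k)
      ≤⟨ *-monoˡ-≤ (e ^ (2 + k)) (+-monoʳ-≤ (2 ^ k) (m≤m+n 4 2)) ⟩
    momentConstant k * e ^ (2 + k) ∎
    where
    open ≤-Reasoning
    k = 2 + i
    δ = λ x z → (n * N x z ∸ e) * (n * N x z ∸ e)
    lemma₁ : ∀ e a b c v → e * (e * a + 4 * (b * c * v)) ≡ e * (e * a + 4 * (c * (b * v)))
    lemma₁ = solve-∀
    lemma₂ : ∀ e a c → e * (e * (a * (e * (e * c))) + 4 * (c * (e * (e * e)))) ≡ (a + 4) * (e * (e * (e * (e * c))))
    lemma₂ = solve-∀

  -- The weights l = b e and m = nᵏ balance the two terms of starSum-lower under moment-bound.
  starSum-bound : ∀ j → τ n * n ^ (2 * suc d + suc j ∸ 1) ≤ e * e * G → .{{_ : NonZero e}} →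
                  n ^ suc j * e ^ suc j ≤ momentConstant (suc j) * starSum n (suc j) E
  starSum-bound j large = *-cancelˡ-≤ (b * (e * e)) {{m*n≢0 b (e * e) {{b≢0}} {{m*n≢0 e e}}}} (+-cancelʳ-≤ (b * (e * e) * (m * e ^ k)) _ _ (begin
    b * (e * e) * (m * e ^ k) + b * (e * e) * (m * e ^ k)
      ≡⟨ lemma₁ b e m (e ^ k) ⟩
    e ^ k * (2 * (b * e * m) * e)
      ≤⟨ starSum-lower k (b * e) m ⟩
    b * e * (b * e) * T + m * m * M k
      ≡⟨ cong (λ s → b * e * (b * e) * T + s) (*-assoc m m (M k)) ⟩
    b * e * (b * e) * T + m * (m * M k)
      ≤⟨ +-monoʳ-≤ (b * e * (b * e) * T) (*-monoʳ-≤ m (moment-bound j large)) ⟩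
    b * e * (b * e) * T + m * (b * e ^ (2 + k))
      ≡⟨ lemma₂ b e m (e ^ k) T ⟩
    b * (e * e) * (b * T) + b * (e * e) * (m * e ^ k) ∎))
    where
    open ≤-Reasoning
    k = suc j
    b = momentConstant k
    m = n ^ k
    T = starSum n k E
    b≢0 : NonZero b
    b≢0 = >-nonZero (≤-trans (s≤s z≤n) (m≤n+m 6 (2 ^ k)))
    lemma₁ : ∀ b e m x → b * (e * e) * (m * x) + b * (e * e) * (m * x) ≡ x * (2 * (b * e * m) * e)
    lemma₁ = solve-∀
    lemma₂ : ∀ b e m x t → b * e * (b * e) * t + m * (b * (e * (e * x))) ≡ b * (e * e) * (b * t) + b * (e * e) * (m * x)
    lemma₂ = solve-∀

-- The size hypothesis appears squared, which clears the square roots, and the conclusion is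
-- multiplied through by |E|ᵏ. `Unique E` makes `length E` the cardinality of a set.
theorem5p1 : ∀ (d k : ℕ) → 1 ≤ d → 1 ≤ k →
    ∃[ C ] ∃[ D ] (1 ≤ D ×
    (∀ (n : ℕ) → 3 ≤ n → n % 2 ≡ 1 →
    (E : List (Vec (Fin n) d)) → Unique E →
    C ^ 2 * τ n * n ^ (2 * d + k ∸ 1) ≤ length E ^ 2 * γ n ^ (d ∸ 1) →
    n ^ k * length E ^ k ≤ D * starSum n k E))
-- C = 1 is large enough; the whole loss sits in D, which is `momentConstant (suc j)` written out.
theorem5p1 (suc d) (suc j) _ _ = 1 , 2 ^ suc j + 6 , m≤n⇒m≤o+n (2 ^ suc j) (s≤s z≤n) , bound
  where
  bound : ∀ (n : ℕ) → 3 ≤ n → n % 2 ≡ 1 → (E : List (Vec (Fin n) (suc d))) → Unique E →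
    1 ^ 2 * τ n * n ^ (2 * suc d + suc j ∸ 1) ≤ length E ^ 2 * γ n ^ d →
    n ^ suc j * length E ^ suc j ≤ (2 ^ suc j + 6) * starSum n (suc j) E
  -- For empty `E` the left side vanishes because k ≥ 1; the other case has |E| > 0, as the
  -- cancellation in `starSum-bound` requires.
  bound n       3≤n _ []        E! large = ≤-trans (≤-reflexive (*-zeroʳ (n ^ suc j))) z≤n
  bound (suc n) 3≤n _ E@(_ ∷ _) E! large = StarMoments.starSum-bound E E! j (≤-trans
    (≤-reflexive (cong (_* suc n ^ (2 * suc d + suc j ∸ 1)) (sym (*-identityˡ (τ (suc n))))))
    (≤-trans large (≤-reflexive (cong (λ s → length E * s * γ (suc n) ^ d) (*-identityʳ (length E))))))
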